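{- Let $n\geq 4$ and let $G_0\in\mathfrak{C}'_{n,1}$ satisfy $F(G_0)=\min\{F(G): G\in\mathfrak{C}'_{n,1}\}$. Then $G_0\cong L_{n,n-1}$.
   Context: All graphs are simple, finite, undirected and connected. $F(G)$ is the number of connected subgraphs of $G$ (nonempty, connected subgraphs, i.e. a vertex subset together with a subset of the edges among them; distinct subgraphs counted separately, so $F(C_n)=n^2+1$). $\mathfrak{C}_{n,k}$ is the family of connected graphs on $n$ vertices with exactly $k$ cut vertices, and $\mathfrak{C}'_{n,k}$ consists of those graphs in $\mathfrak{C}_{n,k}$ that are not trees. $L_{n,n-1}$ is the cycle $C_{n-1}$ with one additional pendant vertex adjacent to a vertex of the cycle. -}

module Defs where

open import Data.Nat using (ℕ; zero; suc; _≤_; _∸_; _≡ᵇ_; _<ᵇ_)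
open import Data.Bool using (Bool; true; false; _∧_; _∨_; not)
open import Data.Fin using (Fin; zero; suc; toℕ; fromℕ; inject₁; _≟_)
open import Data.Vec using (Vec; lookup)
open import Data.List using (List; length)
open import Data.List.Membership.Propositional using (_∈_)
open import Data.List.Relation.Unary.All using (All)
open import Data.List.Relation.Unary.Unique.Propositional using (Unique)
open import Data.Product using (Σ; ∃; _×_; _,_)
open import Relation.Binary.PropositionalEquality using (_≡_; _≢_)
open import Relation.Nullary using (¬_; does)
open import Function.Definitions using (Injective)
open import Function.Bundles using (_↔_; Inverse)

record Graph (n : ℕ) : Set where
  field
    adj    : Fin n → Fin n → Bool
    sym    : ∀ i j → adj i j ≡ adj j i
    irrefl : ∀ i → adj i i ≡ false
open Graph public

data Reach {n : ℕ} (E : Fin n → Fin n → Bool) : Fin n → Fin n → Set where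
  here : ∀ {u} → Reach E u u
  step : ∀ {u w v} → E u w ≡ true → Reach E w v → Reach E u v

Connected : ∀ {n} → Graph n → Set
Connected G = ∀ u v → Reach (adj G) u v

DeleteAdj : ∀ {n} → Graph n → Fin n → Fin n → Fin n → Bool
DeleteAdj G v i j = adj G i j ∧ not (does (i ≟ v)) ∧ not (does (j ≟ v))

IsCutVertex : ∀ {n} → Graph n → Fin n → Set
IsCutVertex G v = ¬ (∀ u w → u ≢ v → w ≢ v → Reach (DeleteAdj G v) u w)

CountIs : ∀ {A : Set} → (A → Set) → ℕ → Set
CountIs {A} P k = Σ (List A) λ xs →
  Unique xs × All P xs × (∀ x → P x → x ∈ xs) × length xs ≡ k

HasCycle : ∀ {n} → Graph n → Set
HasCycle {n} G = Σ ℕ λ m → Σ (Fin (suc (suc (suc m))) → Fin n) λ f →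
  Injective _≡_ _≡_ f ×
  (∀ (i : Fin (suc (suc m))) → adj G (f (inject₁ i)) (f (suc i)) ≡ true) ×
  adj G (f (fromℕ (suc (suc m)))) (f zero) ≡ true

IsTree : ∀ {n} → Graph n → Set
IsTree G = Connected G × ¬ HasCycle G

InC : ∀ {n} → ℕ → Graph n → Set
InC k G = Connected G × CountIs (IsCutVertex G) k

InC' : ∀ {n} → ℕ → Graph n → Set
InC' k G = InC k G × ¬ IsTree G

-- Subgraph data: vertex subset S and edge matrix E (symmetric, so each
-- unordered edge is represented uniquely).
SubG : ℕ → Set
SubG n = Vec Bool n × Vec (Vec Bool n) n

IsConnSubgraph : ∀ {n} → Graph n → SubG n → Set
IsConnSubgraph G (S , E) =
  (∀ i j → e i j ≡ true → adj G i j ≡ true × s i ≡ true × s j ≡ true) ×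
  (∀ i j → e i j ≡ e j i) ×
  (∃ λ i → s i ≡ true) ×
  (∀ i j → s i ≡ true → s j ≡ true → Reach e i j)
  where
  s = lookup S
  e = λ i j → lookup (lookup E i) j

F : ∀ {n} → Graph n → ℕ → Set
F G k = CountIs (IsConnSubgraph G) k

_≅_ : ∀ {n} → (Fin n → Fin n → Bool) → (Fin n → Fin n → Bool) → Set
_≅_ {n} A B = Σ (Fin n ↔ Fin n) λ σ →
  ∀ i j → A i j ≡ B (Inverse.to σ i) (Inverse.to σ j)

-- L_{n,n-1}: cycle on vertices 0,…,n-2 (i ~ i+1, and 0 ~ n-2),
-- plus pendant vertex n-1 adjacent to 0.
LAdj : (n : ℕ) → Fin n → Fin n → Bool
LAdj n a b =
  ((x <ᵇ m) ∧ (y <ᵇ m) ∧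
     ((suc x ≡ᵇ y) ∨ (suc y ≡ᵇ x) ∨ ((x ≡ᵇ 0) ∧ (suc y ≡ᵇ m)) ∨ ((y ≡ᵇ 0) ∧ (suc x ≡ᵇ m))))
  ∨ ((x ≡ᵇ m) ∧ (y ≡ᵇ 0)) ∨ ((y ≡ᵇ m) ∧ (x ≡ᵇ 0))
  where
  x = toℕ a
  y = toℕ b
  m = n ∸ 1

{-# OPTIONS --safe #-}
module Submission where

-- Let v be the cut vertex of G, A a component of G - v with a ≥ 2 vertices, R the set of
-- the remaining r ≥ 1 vertices, B = A ∪ {v}, and T(k) = k(k+1)/2.  For a set D avoiding v
-- let U_D be the component of v in G - D.  If D has at most two vertices in A and at most
-- two in R, then D is exactly the set of neighbours of U_D outside it, because no vertex
-- but v is a cut vertex; so different D give different connected sets.  When D misses A,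
-- an edge of B may be deleted as well, since B has no bridge.  If B has e edges this gives
-- (1 + e + T(a))(1 + T(r)) connected subgraphs through v.  There are also T(a) inside A and
-- r single vertices in R.  All degrees in B are at least 2, so e ≥ a + 1, with equality only
-- if B is a cycle.
--
-- The connected subgraphs of L are determined by an arc, or by the complement of an arc, or
-- by a missing cycle edge, so F(L) is at most the above bound for r = 1, a = n - 2 and
-- e = a + 1.  Comparing the two, minimality forces r = 1 and e = a + 1.

open import Defs renaming (sym to adj-sym; irrefl to adj-irrefl)
open import Data.Bool using (Bool; true; false; _∧_; _∨_; not; T)
import Data.Bool.Properties as Bool
open import Data.Empty using (⊥; ⊥-elim)
open import Data.Fin using (Fin; zero; suc; toℕ; fromℕ; fromℕ<; inject₁; _≟_)
import Data.Fin as Fin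
open import Data.Fin.Properties using (toℕ-injective; toℕ<n; toℕ-fromℕ; toℕ-fromℕ<; toℕ-inject₁; any?; all?; injective⇒≤)
import Data.Fin.Properties as Fin
open import Data.List using (List; []; _∷_; _++_; map; length; filter; allFin; upTo; cartesianProductWith; cartesianProduct; deduplicate; applyUpTo)
open import Data.List.Membership.Propositional using (_∈_; _∉_)
open import Data.List.Membership.Propositional.Properties
open import Data.List.Properties using (length-map; length-++; length-upTo; length-applyUpTo; length-tabulate)
open import Data.List.Relation.Unary.All as All using (All; []; _∷_)
import Data.List.Relation.Unary.All.Properties as All
open import Data.List.Relation.Unary.AllPairs using ([]; _∷_)
open import Data.List.Relation.Unary.Any using (here; there)
open import Data.List.Relation.Unary.Unique.Propositional using (Unique)
import Data.List.Relation.Unary.Unique.Propositional.Properties as Unique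
open import Data.Maybe using (Maybe; just; nothing)
open import Data.Nat using (ℕ; zero; suc; _+_; _*_; _∸_; _≤_; _<_; z≤n; s≤s; _≤?_; _<?_; _≡ᵇ_; _<ᵇ_)
open import Data.Nat.Properties hiding (_≟_)
import Data.Nat as ℕ
open import Data.Nat.Solver using (module +-*-Solver)
open import Data.Product using (∃; ∃₂; _×_; _,_; proj₁; proj₂; uncurry)
open import Data.Sum using (_⊎_; inj₁; inj₂; [_,_])
open import Data.Vec as Vec using (Vec; lookup; tabulate)
import Data.Vec.Properties as Vec
open import Function using (_∘_; id)
open import Function.Bundles using (mk↔ₛ′)
open import Relation.Binary.PropositionalEquality using (_≡_; _≢_; refl; sym; trans; cong; cong₂; subst; subst₂)
open import Relation.Binary.Definitions using (tri<; tri≈; tri>)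
open import Relation.Nullary using (¬_; Dec; yes; no; does; contradiction)
open import Relation.Nullary.Decidable using (_×-dec_; _⊎-dec_; _→-dec_; ¬?; dec-true; dec-false; decidable-stable; map′)

-- The component A has two vertices because G contains a cycle and every cycle has an edge avoiding
-- v. This is what gives each vertex of B a second neighbour in B, hence the degree bound and the
-- absence of bridges. Two deleted vertices per side are the limit because the hypothesis controls
-- the deletion of one vertex at a time: to see that x in D borders U_D, walk from v to x avoiding
-- the other vertex of D on that side. Collapsing everything outside the side to v keeps this walk
-- clear of the deletions on the other side. Unordered pairs with equal entries allowed number T(k),
-- and the empty choice adds 1. R may fall into many components, so apart from the sets through v
-- only its single vertices are counted. For r = 1 and e = a + 1 the bound and the number of shapes
-- of L are the same polynomial. Hence a list covering the connected subgraphs of L is enough, and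
-- the extremal graph is found by comparing numbers, without any graph transformation.

private
  variable
    X Y : Set
    n : ℕ

-- Boolean reflection

true≢false : ∀ {b} → b ≡ true → b ≡ false → ⊥
true≢false refl ()

≢true⇒false : ∀ {b} → b ≢ true → b ≡ false
≢true⇒false {false} _ = refl
≢true⇒false {true}  h = ⊥-elim (h refl)

not-true : ∀ {b} → not b ≡ true → b ≡ false
not-true {false} _ = refl

not-true⁺ : ∀ {b} → b ≡ false → not b ≡ true
not-true⁺ refl = refl

∧-true : ∀ {a b} → a ∧ b ≡ true → a ≡ true × b ≡ true
∧-true {true} {true} _ = refl , refl

∧-true⁺ : ∀ {a b} → a ≡ true → b ≡ true → a ∧ b ≡ true
∧-true⁺ refl refl = refl

∨-true : ∀ {a b} → a ∨ b ≡ true → a ≡ true ⊎ b ≡ true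
∨-true {true}  _ = inj₁ refl
∨-true {false} h = inj₂ h

∨-trueˡ : ∀ {a b} → a ≡ true → a ∨ b ≡ true
∨-trueˡ refl = refl

∨-trueʳ : ∀ a {b} → b ≡ true → a ∨ b ≡ true
∨-trueʳ true  _ = refl
∨-trueʳ false h = h

bool-ext : ∀ {a b} → (a ≡ true → b ≡ true) → (b ≡ true → a ≡ true) → a ≡ b
bool-ext {true}          f g = sym (f refl)
bool-ext {false} {true}  f g = g refl
bool-ext {false} {false} f g = refl

does-true : {P : Set} (d : Dec P) → does d ≡ true → P
does-true (yes p) _ = p

does-false : {P : Set} (d : Dec P) → does d ≡ false → ¬ P
does-false (no ¬p) _ = ¬p

-- Counting with lists

-- Pigeonhole by induction: `f x` is cut out of `ys`, and injectivity keeps the later images clear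
-- of the removed place.
length-inj : (f : X → Y) {xs : List X} {ys : List Y} → Unique xs →
             (∀ {x} → x ∈ xs → f x ∈ ys) →
             (∀ {x y} → x ∈ xs → y ∈ xs → f x ≡ f y → x ≡ y) →
             length xs ≤ length ys
length-inj f {[]} _ _ _ = z≤n
length-inj f {x ∷ xs} {ys} (x∉ ∷ u) sub inj with ∈-∃++ (sub (here refl))
... | ys₁ , ys₂ , refl = subst (suc (length xs) ≤_) (sym len) (s≤s (length-inj f u sub′ (λ p q → inj (there p) (there q))))
  where
  len : length (ys₁ ++ f x ∷ ys₂) ≡ suc (length (ys₁ ++ ys₂))
  len = trans (length-++ ys₁) (trans (+-suc (length ys₁) (length ys₂)) (cong suc (sym (length-++ ys₁))))
  sub′ : ∀ {z} → z ∈ xs → f z ∈ ys₁ ++ ys₂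
  sub′ {z} z∈ with ∈-++⁻ ys₁ (sub (there z∈))
  ... | inj₁ p = ∈-++⁺ˡ p
  ... | inj₂ (there p) = ∈-++⁺ʳ ys₁ p
  ... | inj₂ (here e) = ⊥-elim (All.lookup x∉ z∈ (inj (here refl) (there z∈) (sym e)))

length-⊆ : {xs ys : List X} → Unique xs → (∀ {x} → x ∈ xs → x ∈ ys) → length xs ≤ length ys
length-⊆ u sub = length-inj id u sub (λ _ _ e → e)

length-Unique-≤ : (xs : List (Fin n)) → Unique xs → length xs ≤ n
length-Unique-≤ {n} xs u = subst (length xs ≤_) (length-tabulate {n = n} id) (length-⊆ u (λ {x} _ → ∈-allFin x))

map-Unique : (f : X → Y) {xs : List X} → Unique xs →
             (∀ {x y} → x ∈ xs → y ∈ xs → f x ≡ f y → x ≡ y) → Unique (map f xs)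
map-Unique f {[]} _ _ = []
map-Unique f {x ∷ xs} (x∉ ∷ u) inj =
  All.map⁺ (All.tabulate λ z∈ e → All.lookup x∉ z∈ (inj (here refl) (there z∈) e))
  ∷ map-Unique f u (λ p q → inj (there p) (there q))

∉⇒All≢ : {x : X} {xs : List X} → x ∉ xs → All (x ≢_) xs
∉⇒All≢ x∉ = All.tabulate λ { z∈ refl → x∉ z∈ }

length-cartesianProduct : (xs : List X) (ys : List Y) → length (cartesianProduct xs ys) ≡ length xs * length ys
length-cartesianProduct [] ys = refl
length-cartesianProduct (x ∷ xs) ys =
  trans (length-++ (map (x ,_) ys)) (cong₂ _+_ (length-map (x ,_) ys) (length-cartesianProduct xs ys))

triangle : ℕ → ℕ
triangle zero    = 0
triangle (suc k) = suc k + triangle k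

-- Unordered pairs, possibly with equal entries
pairs : List X → List (X × X)
pairs []       = []
pairs (x ∷ xs) = map (x ,_) (x ∷ xs) ++ pairs xs

length-pairs : (xs : List X) → length (pairs xs) ≡ triangle (length xs)
length-pairs [] = refl
length-pairs (x ∷ xs) = cong suc (trans (length-++ (map (x ,_) xs)) (cong₂ _+_ (length-map (x ,_) xs) (length-pairs xs)))

pairs-∈ : ∀ {x y : X} xs → (x , y) ∈ pairs xs → x ∈ xs × y ∈ xs
pairs-∈ (z ∷ zs) p with ∈-++⁻ (map (z ,_) (z ∷ zs)) p
... | inj₂ q = let a , b = pairs-∈ zs q in there a , there b
... | inj₁ q with ∈-map⁻ (z ,_) q
...   | _ , y∈ , refl = here refl , y∈

∈-pairs : ∀ {x y : X} {xs} → x ∈ xs → y ∈ xs → (x , y) ∈ pairs xs ⊎ (y , x) ∈ pairs xs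
∈-pairs (here refl) q = inj₁ (∈-++⁺ˡ (∈-map⁺ _ q))
∈-pairs (there p) (here refl) = inj₂ (∈-++⁺ˡ (∈-map⁺ _ (there p)))
∈-pairs {xs = z ∷ zs} (there p) (there q) with ∈-pairs p q
... | inj₁ r = inj₁ (∈-++⁺ʳ (map (z ,_) (z ∷ zs)) r)
... | inj₂ r = inj₂ (∈-++⁺ʳ (map (z ,_) (z ∷ zs)) r)

both : X × X → List X
both (x , y) = x ∷ y ∷ []

both-⊆ : ∀ {xs} {p : X × X} → p ∈ pairs xs → ∀ {z} → z ∈ both p → z ∈ xs
both-⊆ {xs = xs} p∈ (here refl) = proj₁ (pairs-∈ xs p∈)
both-⊆ {xs = xs} p∈ (there (here refl)) = proj₂ (pairs-∈ xs p∈)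

-- Each unordered pair is listed in one orientation only, so its set of entries determines it. Sets
-- are compared because deleted vertices will be recovered as a set, without order or multiplicity.
pairs-injective : ∀ {xs : List X} → Unique xs → {p q : X × X} → p ∈ pairs xs → q ∈ pairs xs →
                  (∀ z → z ∈ both p → z ∈ both q) → (∀ z → z ∈ both q → z ∈ both p) → p ≡ q
pairs-injective {xs = x ∷ xs} (x∉ ∷ u) {p} {q} p∈ q∈ p⊆q q⊆p
  with ∈-++⁻ (map (x ,_) (x ∷ xs)) p∈ | ∈-++⁻ (map (x ,_) (x ∷ xs)) q∈
... | inj₂ p∈′ | inj₂ q∈′ = pairs-injective u p∈′ q∈′ p⊆q q⊆p
... | inj₁ p∈′ | inj₂ q∈′ with ∈-map⁻ (x ,_) p∈′
...   | _ , _ , refl = ⊥-elim (All.lookup x∉ (both-⊆ q∈′ (p⊆q x (here refl))) refl)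
pairs-injective {xs = x ∷ xs} (x∉ ∷ u) {p} {q} p∈ q∈ p⊆q q⊆p
    | inj₂ p∈′ | inj₁ q∈′ with ∈-map⁻ (x ,_) q∈′
...   | _ , _ , refl = ⊥-elim (All.lookup x∉ (both-⊆ p∈′ (q⊆p x (here refl))) refl)
pairs-injective {xs = x ∷ xs} (x∉ ∷ u) {p} {q} p∈ q∈ p⊆q q⊆p
    | inj₁ p∈′ | inj₁ q∈′ with ∈-map⁻ (x ,_) p∈′ | ∈-map⁻ (x ,_) q∈′
...   | y , _ , refl | y′ , _ , refl with p⊆q y (there (here refl)) | q⊆p y′ (there (here refl))
...     | there (here refl) | _ = refl
...     | here refl | here refl = refl
...     | here refl | there (here refl) = refl

pairs-Unique : ∀ {xs : List X} → Unique xs → Unique (pairs xs)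
pairs-Unique [] = []
pairs-Unique {xs = x ∷ xs} (x∉ ∷ u) =
  Unique.++⁺ (map-Unique (x ,_) (x∉ ∷ u) λ { _ _ refl → refl }) (pairs-Unique u)
    λ { (p , q) → disj p q }
  where
  disj : ∀ {p} → p ∈ map (x ,_) (x ∷ xs) → p ∈ pairs xs → ⊥
  disj p q with ∈-map⁻ (x ,_) p
  ... | _ , _ , refl = All.lookup x∉ (proj₁ (pairs-∈ xs q)) refl

module _ {P : X → Set} (P? : ∀ x → Dec (P x)) (_≟X_ : (x y : X) → Dec (x ≡ y)) where

  -- Filtering and deduplicating a covering list yields the exact count, so an upper bound asks only
  -- for a cover, which may contain repetitions and elements outside `P`.
  count-cover : (ys : List X) → (∀ x → P x → x ∈ ys) → ∃ λ k → CountIs P k × k ≤ length ys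
  count-cover ys cover = length zs , (zs , zs! , All.tabulate (proj₂ ∘ zs⁻) , zs⁺ , refl)
                       , length-⊆ zs! (proj₁ ∘ zs⁻)
    where
    open import Data.List.Relation.Unary.Unique.DecPropositional.Properties _≟X_ using (deduplicate-!)
    zs : List X
    zs = deduplicate _≟X_ (filter P? ys)
    zs! : Unique zs
    zs! = deduplicate-! (filter P? ys)
    zs⁻ : ∀ {x} → x ∈ zs → x ∈ ys × P x
    zs⁻ x∈ = ∈-filter⁻ P? (∈-deduplicate⁻ _≟X_ (filter P? ys) x∈)
    zs⁺ : ∀ x → P x → x ∈ zs
    zs⁺ x px = ∈-deduplicate⁺ _≟X_ (∈-filter⁺ P? (cover x px) px)

count-≥ : {P : X → Set} {k : ℕ} → CountIs P k → (ys : List X) → Unique ys → All P ys → length ys ≤ k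
count-≥ (xs , _ , _ , cover , refl) ys ys! all = length-⊆ ys! (λ y∈ → cover _ (All.lookup all y∈))

-- Reachability

EdgeRel : ℕ → Set
EdgeRel n = Fin n → Fin n → Bool

reach-trans : {E : EdgeRel n} {u v w : Fin n} → Reach E u v → Reach E v w → Reach E u w
reach-trans here       q = q
reach-trans (step e p) q = step e (reach-trans p q)

reach-edge : {E : EdgeRel n} {u v : Fin n} → E u v ≡ true → Reach E u v
reach-edge e = step e here

-- Replacing edges by walks covers both later uses: collapsing vertices, where an edge may shrink to
-- a point, and rerouting around a deleted edge.
reach-bind : {E E′ : EdgeRel n} (π : Fin n → Fin n) → (∀ i j → E i j ≡ true → Reach E′ (π i) (π j)) →
             ∀ {u v} → Reach E u v → Reach E′ (π u) (π v)
reach-bind π f here       = here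
reach-bind π f (step e p) = reach-trans (f _ _ e) (reach-bind π f p)

reach-map : {E E′ : EdgeRel n} → (∀ i j → E i j ≡ true → E′ i j ≡ true) →
            ∀ {u v} → Reach E u v → Reach E′ u v
reach-map f = reach-bind id (λ i j e → reach-edge (f i j e))

reach-sym : {E : EdgeRel n} → (∀ i j → E i j ≡ true → E j i ≡ true) →
            ∀ {u v} → Reach E u v → Reach E v u
reach-sym s here       = here
reach-sym s (step e p) = reach-trans (reach-sym s p) (reach-edge (s _ _ e))

reach-closed : {E : EdgeRel n} (Q : Fin n → Set) → (∀ i j → E i j ≡ true → Q i → Q j) →
               ∀ {u v} → Reach E u v → Q u → Q v
reach-closed Q c here       q = q
reach-closed Q c (step e p) q = reach-closed Q c p (c _ _ e q)

reach-first : {E : EdgeRel n} {u v : Fin n} → Reach E u v → u ≢ v → ∃ λ w → E u w ≡ true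
reach-first here       u≢u = ⊥-elim (u≢u refl)
reach-first (step e _) _   = _ , e

_∈F?_ : (x : Fin n) (l : List (Fin n)) → Dec (x ∈ l)
_∈F?_ = _∈?_ where open import Data.List.Membership.DecPropositional _≟_

abstract
  member : List (Fin n) → Fin n → Bool
  member l z = does (z ∈F? l)

  member⁺ : ∀ {z : Fin n} {l} → z ∈ l → member l z ≡ true
  member⁺ {z = z} {l} = dec-true (z ∈F? l)

  member⁻ : ∀ {z : Fin n} {l} → member l z ≡ true → z ∈ l
  member⁻ {z = z} {l} = does-true (z ∈F? l)

  nonmember⁺ : ∀ {z : Fin n} {l} → z ∉ l → member l z ≡ false
  nonmember⁺ {z = z} {l} = dec-false (z ∈F? l)

  nonmember⁻ : ∀ {z : Fin n} {l} → member l z ≡ false → z ∉ l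
  nonmember⁻ {z = z} {l} = does-false (z ∈F? l)

-- Every suffix of a growing list is E-connected.
data Grow {n : ℕ} (E : EdgeRel n) (ρ : Fin n) : List (Fin n) → Set where
  root : Grow E ρ (ρ ∷ [])
  add  : ∀ {y z l} → Grow E ρ l → z ∈ l → E z y ≡ true → y ∉ l → Grow E ρ (y ∷ l)

Closed : EdgeRel n → List (Fin n) → Set
Closed E l = ∀ z y → z ∈ l → E z y ≡ true → y ∈ l

grow-Unique : ∀ {E : EdgeRel n} {ρ l} → Grow E ρ l → Unique l
grow-Unique root          = [] ∷ []
grow-Unique (add g _ _ y∉) = ∉⇒All≢ y∉ ∷ grow-Unique g

grow-root : ∀ {E : EdgeRel n} {ρ l} → Grow E ρ l → ρ ∈ l
grow-root root          = here refl
grow-root (add g _ _ _) = there (grow-root g)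

grow-reach : ∀ {E : EdgeRel n} {ρ l} → Grow E ρ l → ∀ {z} → z ∈ l → Reach E ρ z
grow-reach root             (here refl) = here
grow-reach (add g z∈ e _)   (here refl) = reach-trans (grow-reach g z∈) (reach-edge e)
grow-reach (add g _ _ _)    (there p)   = grow-reach g p

closed-reach : ∀ {E : EdgeRel n} {l ρ z} → Closed E l → ρ ∈ l → Reach E ρ z → z ∈ l
closed-reach {l = l} cl ρ∈ p = reach-closed (_∈ l) (λ i j e i∈ → cl i j i∈ e) p ρ∈

module _ {n : ℕ} (E : EdgeRel n) (ρ : Fin n) where

  exit? : (l : List (Fin n)) → Dec (∃ λ z → ∃ λ y → z ∈ l × E z y ≡ true × y ∉ l)
  exit? l = any? λ z → any? λ y → (z ∈F? l) ×-dec (E z y Bool.≟ true) ×-dec ¬? (y ∈F? l)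

  -- A grown list has distinct entries, hence at most `n` of them, so the fuel cannot run out before
  -- the list is closed.
  saturate : (fuel : ℕ) (l : List (Fin n)) → Grow E ρ l → n < fuel + length l →
             ∃ λ l′ → Grow E ρ l′ × Closed E l′
  saturate zero l g h = contradiction (length-Unique-≤ l (grow-Unique g)) (<⇒≱ h)
  saturate (suc k) l g h with exit? l
  ... | yes (z , y , z∈ , e , y∉) = saturate k (y ∷ l) (add g z∈ e y∉) (subst (n <_) (sym (+-suc k (length l))) h)
  ... | no none = l , g , λ z y z∈ e → decidable-stable (y ∈F? l) (λ y∉ → none (z , y , z∈ , e , y∉))

  component : ∃ λ l → Grow E ρ l × Closed E l
  component = saturate n (ρ ∷ []) root (subst (n <_) (+-comm 1 n) (n<1+n n))

  reach? : (z : Fin n) → Dec (Reach E ρ z)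
  reach? z with component
  ... | l , g , cl = map′ (grow-reach g) (closed-reach cl (grow-root g)) (z ∈F? l)

-- Subgraphs

subgraph : (Fin n → Bool) → EdgeRel n → SubG n
subgraph S E = tabulate S , tabulate (λ i → tabulate (E i))

lookup-edges : (E : EdgeRel n) (i j : Fin n) → lookup (lookup (tabulate (λ i → tabulate (E i))) i) j ≡ E i j
lookup-edges E i j = trans (cong (λ r → lookup r j) (Vec.lookup∘tabulate (λ i → tabulate (E i)) i)) (Vec.lookup∘tabulate (E i) j)

subgraph-injective : {S S′ : Fin n → Bool} {E E′ : EdgeRel n} → subgraph S E ≡ subgraph S′ E′ →
                     (∀ i → S i ≡ S′ i) × (∀ i j → E i j ≡ E′ i j)
subgraph-injective {S = S} {S′} {E} {E′} eq =
    (λ i → trans (sym (Vec.lookup∘tabulate S i)) (trans (cong (λ r → lookup (proj₁ r) i) eq) (Vec.lookup∘tabulate S′ i)))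
  , (λ i j → trans (sym (lookup-edges E i j)) (trans (cong (λ r → lookup (lookup (proj₂ r) i) j) eq) (lookup-edges E′ i j)))

subgraph-complete : (H : SubG n) {S : Fin n → Bool} {E : EdgeRel n} → (∀ i → lookup (proj₁ H) i ≡ S i) →
                    (∀ i j → lookup (lookup (proj₂ H) i) j ≡ E i j) → H ≡ subgraph S E
subgraph-complete (s , e) hs he = cong₂ _,_
  (trans (sym (Vec.tabulate∘lookup s)) (Vec.tabulate-cong hs))
  (trans (sym (Vec.tabulate∘lookup e)) (Vec.tabulate-cong λ i →
    trans (sym (Vec.tabulate∘lookup (lookup e i))) (Vec.tabulate-cong (he i))))

subgraph-connected : (G : Graph n) {S : Fin n → Bool} {E : EdgeRel n} (ρ : Fin n) →
  (∀ i j → E i j ≡ true → adj G i j ≡ true × S i ≡ true × S j ≡ true) →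
  (∀ i j → E i j ≡ true → E j i ≡ true) →
  S ρ ≡ true → (∀ z → S z ≡ true → Reach E ρ z) → IsConnSubgraph G (subgraph S E)
subgraph-connected G {S} {E} ρ sub sy ρ∈ conn =
    (λ i j e → let a , b , c = sub i j (trans (sym (lookup-edges E i j)) e)
               in a , trans (Vec.lookup∘tabulate S i) b , trans (Vec.lookup∘tabulate S j) c)
  , (λ i j → trans (lookup-edges E i j) (trans (bool-ext (sy i j) (sy j i)) (sym (lookup-edges E j i))))
  , (ρ , trans (Vec.lookup∘tabulate S ρ) ρ∈)
  , (λ i j si sj → reach-map (λ i j e → trans (lookup-edges E i j) e)
      (reach-trans (reach-sym sy (conn i (trans (sym (Vec.lookup∘tabulate S i)) si)))
                   (conn j (trans (sym (Vec.lookup∘tabulate S j)) sj))))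

isConnSubgraph? : (G : Graph n) (H : SubG n) → Dec (IsConnSubgraph G H)
isConnSubgraph? G (S , E) =
  (all? λ i → all? λ j → (_ Bool.≟ true) →-dec ((_ Bool.≟ true) ×-dec (_ Bool.≟ true) ×-dec (_ Bool.≟ true)))
  ×-dec (all? λ i → all? λ j → _ Bool.≟ _)
  ×-dec (any? λ i → _ Bool.≟ true)
  ×-dec (all? λ i → all? λ j → (_ Bool.≟ true) →-dec (_ Bool.≟ true) →-dec reach? (λ i j → lookup (lookup E i) j) i j)

_≟SubG_ : (H K : SubG n) → Dec (H ≡ K)
_≟SubG_ = Product.≡-dec (Vec.≡-dec Bool._≟_) (Vec.≡-dec (Vec.≡-dec Bool._≟_))
  where import Data.Product.Properties as Product

allVec : List X → (k : ℕ) → List (Vec X k)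
allVec xs zero    = Vec.[] ∷ []
allVec xs (suc k) = cartesianProductWith Vec._∷_ xs (allVec xs k)

∈-allVec : {xs : List X} → (∀ x → x ∈ xs) → ∀ {k} (v : Vec X k) → v ∈ allVec xs k
∈-allVec all Vec.[]      = here refl
∈-allVec all (x Vec.∷ v) = ∈-cartesianProductWith⁺ _ (all x) (∈-allVec all v)

-- `F` is a relation, so minimality says something only once values are supplied; they exist because
-- all candidate subgraphs can be listed and tested.
F-exists : (G : Graph n) → ∃ λ k → F G k
F-exists {n} G =
  let k , c , _ = count-cover (isConnSubgraph? G) _≟SubG_ (cartesianProduct (allVec bools n) (allVec (allVec bools n) n))
                    (λ H _ → ∈-cartesianProduct⁺ (∈-allVec bools-all _) (∈-allVec (∈-allVec bools-all) _))
  in k , c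
  where
  bools : List Bool
  bools = true ∷ false ∷ []
  bools-all : ∀ b → b ∈ bools
  bools-all true  = here refl
  bools-all false = there (here refl)

-- Components of vertex-deleted subgraphs

vertex : SubG n → Fin n → Bool
vertex H = lookup (proj₁ H)

vertex-subgraph : (S : Fin n → Bool) (E : EdgeRel n) (z : Fin n) → vertex (subgraph S E) z ≡ S z
vertex-subgraph S E = Vec.lookup∘tabulate S

module Components {n : ℕ} (G : Graph n) where

  adj-swap : ∀ i j → adj G i j ≡ true → adj G j i ≡ true
  adj-swap i j e = trans (adj-sym G j i) e

  adj⇒≢ : ∀ {i j} → adj G i j ≡ true → i ≢ j
  adj⇒≢ e refl = true≢false e (adj-irrefl G _)

  DeleteAdj⁺ : ∀ {x i j} → adj G i j ≡ true → i ≢ x → j ≢ x → DeleteAdj G x i j ≡ true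
  DeleteAdj⁺ {x} {i} {j} e p q =
    ∧-true⁺ e (∧-true⁺ (not-true⁺ (dec-false (i ≟ x) p)) (not-true⁺ (dec-false (j ≟ x) q)))

  DeleteAdj⁻ : ∀ {x i j} → DeleteAdj G x i j ≡ true → adj G i j ≡ true × i ≢ x × j ≢ x
  DeleteAdj⁻ {x} {i} {j} e with ∧-true e
  ... | a , bc with ∧-true {not (does (i ≟ x))} bc
  ...   | b , c = a , does-false (i ≟ x) (not-true b) , does-false (j ≟ x) (not-true c)

  abstract
    induced : (Fin n → Bool) → EdgeRel n
    induced S i j = adj G i j ∧ S i ∧ S j

    induced⁺ : ∀ {S i j} → adj G i j ≡ true → S i ≡ true → S j ≡ true → induced S i j ≡ true
    induced⁺ a b c = ∧-true⁺ a (∧-true⁺ b c)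

    induced⁻ : ∀ {S i j} → induced S i j ≡ true → adj G i j ≡ true × S i ≡ true × S j ≡ true
    induced⁻ e = let a , bc = ∧-true e in a , ∧-true bc

  induced-sym : ∀ S i j → induced S i j ≡ true → induced S j i ≡ true
  induced-sym S i j e = let a , b , c = induced⁻ e in induced⁺ (adj-swap i j a) c b

  abstract
    comp : (Fin n → Bool) → Fin n → Fin n → Bool
    comp S ρ z = does (reach? (induced S) ρ z)

    comp⁺ : ∀ {S ρ z} → Reach (induced S) ρ z → comp S ρ z ≡ true
    comp⁺ {S} {ρ} {z} = dec-true (reach? (induced S) ρ z)

    comp⁻ : ∀ {S ρ z} → comp S ρ z ≡ true → Reach (induced S) ρ z
    comp⁻ {S} {ρ} {z} = does-true (reach? (induced S) ρ z)

  -- The empty walk puts `ρ` into `comp S ρ` in every case, which is why `S ρ` is assumed.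
  comp-⊆ : ∀ {S ρ} → S ρ ≡ true → ∀ {z} → comp S ρ z ≡ true → S z ≡ true
  comp-⊆ {S} Sρ c = reach-closed (λ z → S z ≡ true) (λ i j e _ → proj₂ (proj₂ (induced⁻ {S} e))) (comp⁻ c) Sρ

  comp-step : ∀ {S ρ u z} → S ρ ≡ true → comp S ρ u ≡ true → adj G u z ≡ true → S z ≡ true → comp S ρ z ≡ true
  comp-step {S} {ρ} Sρ c e Sz =
    comp⁺ (reach-trans (comp⁻ c) (reach-edge (induced⁺ {S} e (comp-⊆ {S} {ρ} Sρ c) Sz)))

  -- Every vertex passed by a walk from `ρ` in `S` is itself reached, so the walk never leaves the
  -- component.
  comp-connected : ∀ {S ρ z} → comp S ρ z ≡ true → Reach (induced (comp S ρ)) ρ z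
  comp-connected {S} {ρ} c = go (comp⁺ {S} {ρ} here) (comp⁻ c)
    where
    go : ∀ {u z} → comp S ρ u ≡ true → Reach (induced S) u z → Reach (induced (comp S ρ)) u z
    go cu here = here
    go {u} cu (step {w = w} e p) = step (induced⁺ {comp S ρ} (proj₁ (induced⁻ {S} e)) cu cw) (go cw p)
      where
      cw : comp S ρ w ≡ true
      cw = comp⁺ {S} {ρ} (reach-trans (comp⁻ cu) (reach-edge e))

  -- The outer vertex boundary of `U`.
  Frontier : (Fin n → Bool) → Fin n → Set
  Frontier U z = U z ≡ false × ∃ λ u → U u ≡ true × adj G u z ≡ true

  frontier-cong : ∀ {U U′} → (∀ z → U z ≡ U′ z) → ∀ {z} → Frontier U z → Frontier U′ z
  frontier-cong eq (a , u , b , c) = trans (sym (eq _)) a , u , trans (sym (eq _)) b , c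

  -- A boundary vertex inside `S` would have been absorbed by the component. This is one half of
  -- reading off D from U_D; `frontier-walk` serves the other.
  frontier-removed : ∀ {S ρ} → S ρ ≡ true → ∀ {z} → Frontier (comp S ρ) z → S z ≡ false
  frontier-removed {S} {ρ} Sρ (a , u , b , c) =
    ≢true⇒false λ Sz → true≢false (comp-step {S} {ρ} Sρ b c Sz) a

  -- The walk remains in the component until it first arrives at `x`, so the vertex before that
  -- arrival is a neighbour of `x` in the component.
  frontier-walk : ∀ {S ρ x} {E : EdgeRel n} → S ρ ≡ true → S x ≡ false →
                  (∀ i j → E i j ≡ true → adj G i j ≡ true × (j ≡ x ⊎ S j ≡ true)) →
                  Reach E ρ x → Frontier (comp S ρ) x
  frontier-walk {S} {ρ} {x} {E} Sρ Sx ok p = out , go (comp⁺ {S} {ρ} here) p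
    where
    out : comp S ρ x ≡ false
    out = ≢true⇒false λ c → true≢false (comp-⊆ {S} {ρ} Sρ c) Sx
    go : ∀ {u} → comp S ρ u ≡ true → Reach E u x → ∃ λ w → comp S ρ w ≡ true × adj G w x ≡ true
    go cu here = ⊥-elim (true≢false cu out)
    go {u} cu (step {w = w} e q) with ok u w e
    ... | a , inj₁ refl = u , cu , a
    ... | a , inj₂ Sw   = go (comp-step {S} {ρ} Sρ cu a Sw) q

  induced-mono : ∀ {S S′} → (∀ z → S z ≡ true → S′ z ≡ true) → ∀ {u w} → Reach (induced S) u w → Reach (induced S′) u w
  induced-mono {S} {S′} sub = reach-map λ i j e → let a , b , c = induced⁻ {S} e in induced⁺ {S′} a (sub i b) (sub j c)

  grow-induced : ∀ {E : EdgeRel n} {ρ l} → (∀ i j → E i j ≡ true → adj G i j ≡ true) → Grow E ρ l →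
                 ∀ {z} → z ∈ l → Reach (induced (member l)) ρ z
  grow-induced E⊆ root (here refl) = here
  grow-induced {E} {ρ} {y ∷ l} E⊆ (add {z = x} g x∈ e y∉) {z} z∈ = from z∈
    where
    older : ∀ {z} → z ∈ l → Reach (induced (member (y ∷ l))) ρ z
    older p = induced-mono {member l} {member (y ∷ l)} (λ z m → member⁺ {l = y ∷ l} (there (member⁻ {l = l} m))) (grow-induced E⊆ g p)
    from : z ∈ y ∷ l → Reach (induced (member (y ∷ l))) ρ z
    from (there p) = older p
    from (here refl) = reach-trans (older x∈)
      (reach-edge (induced⁺ {member (y ∷ l)} (E⊆ _ _ e) (member⁺ {l = y ∷ l} (there x∈)) (member⁺ {l = y ∷ l} (here refl))))

  inducedSub : (Fin n → Bool) → SubG n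
  inducedSub U = subgraph U (induced U)

  inducedSub-connected : ∀ {S ρ} → IsConnSubgraph G (inducedSub (comp S ρ))
  inducedSub-connected {S} {ρ} = subgraph-connected G ρ (λ i j → induced⁻ {comp S ρ}) (induced-sym (comp S ρ))
    (comp⁺ {S} {ρ} here) (λ z → comp-connected {S} {ρ})

  -- A connected graph on k vertices has at least k connected vertex sets containing a
  -- given vertex y: the whole set, and the component of y after deleting one vertex x ≠ y.
  hole : Maybe (Fin n) → List (Fin n)
  hole nothing  = []
  hole (just x) = x ∷ []

  abstract
    punctured : List (Fin n) → Maybe (Fin n) → Fin n → Bool
    punctured l c z = member l z ∧ not (member (hole c) z)

    punctured⁺ : ∀ {l c z} → z ∈ l → z ∉ hole c → punctured l c z ≡ true
    punctured⁺ {l} {c} z∈ z∉ = ∧-true⁺ (member⁺ {l = l} z∈) (not-true⁺ (nonmember⁺ {l = hole c} z∉))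

    punctured⁻ : ∀ {l c z} → punctured l c z ≡ true → z ∈ l × z ∉ hole c
    punctured⁻ {l} {c} h = let a , b = ∧-true h in member⁻ a , nonmember⁻ {l = hole c} (not-true b)

  rooted : Fin n → List (Fin n) → Maybe (Fin n) → SubG n
  rooted y t c = inducedSub (comp (punctured (y ∷ t) c) y)

  -- Subgraphs are sorted by their latest vertex `y` in the growth order. The suffix `y ∷ t` is
  -- connected and offers `length (y ∷ t)` sets containing `y`; later suffixes lack `y`, so nothing
  -- is counted twice and the sum is triangular.
  rootedSubs : List (Fin n) → List (SubG n)
  rootedSubs []      = []
  rootedSubs (y ∷ t) = map (rooted y t) (nothing ∷ map just t) ++ rootedSubs t

  length-rootedSubs : ∀ l → length (rootedSubs l) ≡ triangle (length l)
  length-rootedSubs [] = refl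
  length-rootedSubs (y ∷ t) = cong suc (trans (length-++ (map (rooted y t) (map just t)))
    (cong₂ _+_ (trans (length-map (rooted y t) (map just t)) (length-map just t)) (length-rootedSubs t)))

  rootedSubs-connected : ∀ l → All (IsConnSubgraph G) (rootedSubs l)
  rootedSubs-connected [] = []
  rootedSubs-connected (y ∷ t) = All.++⁺ (All.map⁺ (All.tabulate λ {c} _ → inducedSub-connected {punctured (y ∷ t) c})) (rootedSubs-connected t)

  code∉ : ∀ {y : Fin n} {t c} → y ∉ t → c ∈ (nothing ∷ map just t) → y ∉ hole c
  code∉ y∉ (here refl) ()
  code∉ y∉ (there p) q with ∈-map⁻ just p
  code∉ y∉ (there p) (here refl) | _ , x∈ , refl = y∉ x∈
  code∉ y∉ (there p) (there ())  | _ , x∈ , refl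

  punctured-root : ∀ {y t c} → y ∉ t → c ∈ (nothing ∷ map just t) → punctured (y ∷ t) c y ≡ true
  punctured-root {y} {t} {c} y∉ c∈ = punctured⁺ {y ∷ t} {c} (here refl) (code∉ y∉ c∈)

  rootedSubs-⊆ : ∀ {l} → Unique l → ∀ {H} → H ∈ rootedSubs l → ∀ z → vertex H z ≡ true → z ∈ l
  rootedSubs-⊆ {y ∷ t} (y≢ ∷ u) H∈ z hz with ∈-++⁻ (map (rooted y t) (nothing ∷ map just t)) H∈
  ... | inj₂ q = there (rootedSubs-⊆ u q z hz)
  ... | inj₁ q with ∈-map⁻ (rooted y t) q
  ...   | c , c∈ , refl = (proj₁ (punctured⁻ {y ∷ t} {c} (comp-⊆ {punctured (y ∷ t) c} {y} (punctured-root (λ y∈ → All.lookup y≢ y∈ refl) c∈)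
          (trans (sym (vertex-subgraph (comp (punctured (y ∷ t) c) y) (induced (comp (punctured (y ∷ t) c) y)) z)) hz))))

  module _ {E : EdgeRel n} {ρ : Fin n} (E⊆ : ∀ i j → E i j ≡ true → adj G i j ≡ true) where

    hole-frontier : ∀ {y t c} → Grow E ρ (y ∷ t) → c ∈ (nothing ∷ map just t) → ∀ {x} → x ∈ hole c →
                    Frontier (comp (punctured (y ∷ t) c) y) x
    hole-frontier g (here refl) ()
    hole-frontier {y} {t} {c} g (there c∈) x∈ with ∈-map⁻ just c∈
    hole-frontier {y} {t} {c} g (there c∈) {x} (here refl) | _ , x∈t , refl =
      frontier-walk {punctured (y ∷ t) (just x)} {y} {E = induced (member (y ∷ t))}
        (punctured-root y∉ (there c∈))
        (≢true⇒false λ h → proj₂ (punctured⁻ {y ∷ t} {just x} h) (here refl))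
        ok (reach-trans (reach-sym (induced-sym _) (grow-induced E⊆ g (here refl))) (grow-induced E⊆ g (there x∈t)))
      where
      y∉ : y ∉ t
      y∉ = Unique.Unique[x∷xs]⇒x∉xs (grow-Unique g)
      ok : ∀ i j → induced (member (y ∷ t)) i j ≡ true → adj G i j ≡ true × (j ≡ x ⊎ punctured (y ∷ t) (just x) j ≡ true)
      ok i j e = let a , _ , c = induced⁻ {member (y ∷ t)} e in a , split c (j ≟ x)
        where
        split : member (y ∷ t) j ≡ true → Dec (j ≡ x) → j ≡ x ⊎ punctured (y ∷ t) (just x) j ≡ true
        split c (yes p) = inj₁ p
        split c (no ¬p) = inj₂ (punctured⁺ {y ∷ t} {just x} (member⁻ c) λ { (here q) → ¬p q })

    -- The deleted vertex borders the component of `y`. If the same component arises from `c′`, that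
    -- vertex must be missing there too, and inside `t` only the hole of `c′` is missing.
    rooted-hole : ∀ {y t c c′} → Grow E ρ (y ∷ t) → c ∈ (nothing ∷ map just t) → c′ ∈ (nothing ∷ map just t) →
                  rooted y t c ≡ rooted y t c′ → ∀ {x} → x ∈ hole c → x ∈ t → x ∈ hole c′
    rooted-hole {y} {t} {c} {c′} g c∈ c′∈ eq {x} x∈ x∈t = decidable-stable (x ∈F? hole c′) λ x∉ →
      true≢false (punctured⁺ {y ∷ t} {c′} (there x∈t) x∉)
        (frontier-removed {punctured (y ∷ t) c′} {y} (punctured-root y∉ c′∈)
          (frontier-cong (proj₁ (subgraph-injective eq)) (hole-frontier {c = c} g c∈ x∈)))
      where
      y∉ : y ∉ t
      y∉ = Unique.Unique[x∷xs]⇒x∉xs (grow-Unique g)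

    rooted-injective : ∀ {y t} → Grow E ρ (y ∷ t) → ∀ {c c′} → c ∈ (nothing ∷ map just t) → c′ ∈ (nothing ∷ map just t) →
                       rooted y t c ≡ rooted y t c′ → c ≡ c′
    rooted-injective g (here refl) (here refl) eq = refl
    rooted-injective g (here refl) (there q) eq with ∈-map⁻ just q
    ... | x , x∈ , refl with rooted-hole g (there q) (here refl) (sym eq) (here refl) x∈
    ...   | ()
    rooted-injective g (there p) c′∈ eq with ∈-map⁻ just p
    rooted-injective g {c′ = c′} (there p) c′∈ eq | x , x∈ , refl with c′ | rooted-hole g (there p) c′∈ eq (here refl) x∈
    ... | just _ | here refl = refl

    rootedSubs-Unique : ∀ {l} → Grow E ρ l → Unique (rootedSubs l)
    rootedSubs-Unique {y ∷ t} g with grow-Unique g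
    ... | y≢ ∷ u = Unique.++⁺
      (map-Unique (rooted y t) (All.map⁺ (All.tabulate λ _ ()) ∷ map-Unique just u λ { _ _ refl → refl }) (rooted-injective g))
      (tail g)
      (λ { (p , q) → disj p q })
      where
      tail : ∀ {y t} → Grow E ρ (y ∷ t) → Unique (rootedSubs t)
      tail root = []
      tail (add g _ _ _) = rootedSubs-Unique g
      disj : ∀ {H} → H ∈ map (rooted y t) (nothing ∷ map just t) → H ∈ rootedSubs t → ⊥
      disj p q with ∈-map⁻ (rooted y t) p
      ... | c , c∈ , refl = All.lookup y≢ (rootedSubs-⊆ u q y
        (trans (vertex-subgraph (comp (punctured (y ∷ t) c) y) (induced (comp (punctured (y ∷ t) c) y)) y) (comp⁺ {punctured (y ∷ t) c} {y} here))) refl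

-- Separated sides of a vertex

module Sides {n : ℕ} (G : Graph n) (conn : Connected G) (v : Fin n)
  (noncut : ∀ x → x ≢ v → ∀ u w → u ≢ x → w ≢ x → Reach (DeleteAdj G x) u w) where

  open Components G public

  -- The sides are exactly the unions of components of `G` minus `v`. The remainder R need not be a
  -- single component, hence this generality.
  record Side (S : Fin n → Bool) : Set where
    field
      v∉    : S v ≡ false
      exits : ∀ {i j} → adj G i j ≡ true → S i ≡ true → S j ≡ true ⊎ j ≡ v

    ≢v : ∀ {x} → S x ≡ true → x ≢ v
    ≢v Sx refl = true≢false Sx v∉
  open Side public

  abstract
    with-v : (Fin n → Bool) → Fin n → Bool
    with-v S z = does (z ≟ v) ∨ S z

    with-v⁻ : ∀ {S z} → with-v S z ≡ true → z ≡ v ⊎ S z ≡ true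
    with-v⁻ {z = z} h with ∨-true h
    ... | inj₁ p = inj₁ (does-true (z ≟ v) p)
    ... | inj₂ q = inj₂ q

    with-v-v : ∀ {S} → with-v S v ≡ true
    with-v-v {S} = cong (_∨ S v) (dec-true (v ≟ v) refl)

    with-v⁺ : ∀ {S z} → S z ≡ true → with-v S z ≡ true
    with-v⁺ {z = z} Sz = ∨-trueʳ (does (z ≟ v)) Sz

  side-exits : ∀ {S i j} → Side S → adj G i j ≡ true → S i ≡ true → with-v S j ≡ true
  side-exits {S} s e Si with exits s e Si
  ... | inj₁ Sj   = with-v⁺ Sj
  ... | inj₂ refl = with-v-v

  retract : (Fin n → Bool) → Fin n → Fin n
  retract S z with with-v S z
  ... | true  = z
  ... | false = v

  retract-in : ∀ {S z} → with-v S z ≡ true → retract S z ≡ z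
  retract-in h rewrite h = refl

  abstract
    restrict : EdgeRel n → (Fin n → Bool) → EdgeRel n
    restrict E S i j = E i j ∧ S i ∧ S j

    restrict⁻ : ∀ {E S i j} → restrict E S i j ≡ true → E i j ≡ true × S i ≡ true × S j ≡ true
    restrict⁻ h = let a , b = ∧-true h in a , ∧-true b

    restrict⁺ : ∀ {E S i j} → E i j ≡ true → S i ≡ true → S j ≡ true → restrict E S i j ≡ true
    restrict⁺ a b c = ∧-true⁺ a (∧-true⁺ b c)

  -- Collapsing everything outside the side to v turns a walk into a walk inside the side.
  side-walk : ∀ {S} {E : EdgeRel n} → Side S → (∀ i j → E i j ≡ true → adj G i j ≡ true) →
              ∀ {s t} → with-v S s ≡ true → with-v S t ≡ true → Reach E s t → Reach (restrict E (with-v S)) s t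
  side-walk {S} {E} sd E⊆ {s} {t} hs ht p =
    subst₂ (Reach (restrict E (with-v S))) (retract-in hs) (retract-in ht) (reach-bind (retract S) move p)
    where
    move : ∀ i j → E i j ≡ true → Reach (restrict E (with-v S)) (retract S i) (retract S j)
    move i j e with with-v S i in hi | with-v S j in hj
    ... | true  | true  = reach-edge (restrict⁺ e hi hj)
    ... | false | false = here
    -- An edge leaving the side together with `v` has to start at `v`, so collapsing shrinks it to
    -- the empty walk.
    ... | true  | false with with-v⁻ hi
    ...   | inj₁ refl = here
    ...   | inj₂ Si   = ⊥-elim (true≢false (side-exits sd (E⊆ i j e) Si) hj)
    move i j e | false | true with with-v⁻ hj
    ...   | inj₁ refl = here
    ...   | inj₂ Sj   = ⊥-elim (true≢false (side-exits sd (adj-swap i j (E⊆ i j e)) Sj) hi)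

  side-connected : ∀ {S} → Side S → ∀ {x} → S x ≡ true → Reach (induced (with-v S)) v x
  side-connected {S} sd Sx = reach-map (λ i j e → let a , b , c = restrict⁻ e in induced⁺ a b c)
    (side-walk sd (λ _ _ e → e) with-v-v (with-v⁺ Sx) (conn v _))

  side-avoid : ∀ {S} → Side S → ∀ {x u w} → S x ≡ true → u ≢ x → w ≢ x → with-v S u ≡ true → with-v S w ≡ true →
               Reach (restrict (DeleteAdj G x) (with-v S)) u w
  side-avoid sd Sx u≢ w≢ hu hw = side-walk sd (λ i j e → proj₁ (DeleteAdj⁻ e)) hu hw (noncut _ (≢v sd Sx) _ _ u≢ w≢)

  abstract
    without : List (Fin n) → Fin n → Bool
    without D z = not (member D z)

    without⁺ : ∀ {D z} → z ∉ D → without D z ≡ true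
    without⁺ z∉ = not-true⁺ (nonmember⁺ z∉)

    without-false⁺ : ∀ {D z} → z ∈ D → without D z ≡ false
    without-false⁺ z∈ = cong not (member⁺ z∈)

    without-false⁻ : ∀ {D z} → without D z ≡ false → z ∈ D
    without-false⁻ {D} {z} h = decidable-stable (z ∈F? D) λ z∉ → true≢false (not-true⁺ (nonmember⁺ z∉)) h

  -- Equal entries in `two` stand for one deleted vertex, so zero, one and two deletions are all
  -- covered.
  data Gap (S : Fin n → Bool) : List (Fin n) → Set where
    none : Gap S []
    two  : ∀ {x y} → S x ≡ true → S y ≡ true → Gap S (x ∷ y ∷ [])

  -- As no vertex other than v is a cut vertex, x is joined to v avoiding y within the side.
  separator-frontier : ∀ {S} → Side S → ∀ {x y D} → S x ≡ true → S y ≡ true → v ∉ D → x ∈ D →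
    (∀ z → S z ≡ true → z ∈ D → z ≡ x ⊎ z ≡ y) → Frontier (comp (without D) v) x
  separator-frontier {S} sd {x} {y} {D} Sx Sy v∉D x∈D only with y ≟ x
  -- Only `x` is deleted on this side, so any walk from `v` to `x` within the side will do.
  ... | yes refl = frontier-walk (without⁺ v∉D) (without-false⁺ x∈D) ok (side-connected sd Sx)
    where
    ok : ∀ i j → induced (with-v S) i j ≡ true → adj G i j ≡ true × (j ≡ x ⊎ without D j ≡ true)
    ok i j e with induced⁻ e
    ... | a , _ , c with with-v⁻ c | j ≟ x
    ...   | _ | yes j≡x = a , inj₁ j≡x
    ...   | inj₁ refl | no _ = a , inj₂ (without⁺ v∉D)
    ...   | inj₂ Sj | no j≢x = a , inj₂ (without⁺ λ j∈ → [ j≢x , j≢x ] (only j Sj j∈))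
  ... | no y≢x = frontier-walk (without⁺ v∉D) (without-false⁺ x∈D) ok
                   (side-avoid sd Sy (≢v sd Sy ∘ sym) (y≢x ∘ sym) with-v-v (with-v⁺ Sx))
    where
    ok : ∀ i j → restrict (DeleteAdj G y) (with-v S) i j ≡ true → adj G i j ≡ true × (j ≡ x ⊎ without D j ≡ true)
    ok i j e with restrict⁻ e
    ... | d , _ , c with DeleteAdj⁻ d
    ...   | a , _ , j≢y with with-v⁻ c | j ≟ x
    ...     | _ | yes j≡x = a , inj₁ j≡x
    ...     | inj₁ refl | no _ = a , inj₂ (without⁺ v∉D)
    ...     | inj₂ Sj | no j≢x = a , inj₂ (without⁺ λ j∈ → [ j≢x , j≢y ] (only j Sj j∈))

  gap-frontier : ∀ {S} → Side S → ∀ {d D} → Gap S d → v ∉ D → (∀ {z} → z ∈ d → z ∈ D) →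
    (∀ {z} → S z ≡ true → z ∈ D → z ∈ d) → ∀ {x} → x ∈ d → Frontier (comp (without D) v) x
  gap-frontier sd (two {x} {y} Sx Sy) v∉D d⊆ ⊆d (here refl) =
    separator-frontier sd Sx Sy v∉D (d⊆ (here refl)) λ z Sz z∈ → elim (⊆d Sz z∈)
    where
    elim : ∀ {z} → z ∈ x ∷ y ∷ [] → z ≡ x ⊎ z ≡ y
    elim (here p)         = inj₁ p
    elim (there (here p)) = inj₂ p
  gap-frontier sd (two {x} {y} Sx Sy) v∉D d⊆ ⊆d (there (here refl)) =
    separator-frontier sd Sy Sx v∉D (d⊆ (there (here refl))) λ z Sz z∈ → elim (⊆d Sz z∈)
    where
    elim : ∀ {z} → z ∈ x ∷ y ∷ [] → z ≡ y ⊎ z ≡ x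
    elim (here p)         = inj₂ p
    elim (there (here p)) = inj₁ p

  gap-⊆ : ∀ {S d} → Gap S d → ∀ {z} → z ∈ d → S z ≡ true
  gap-⊆ (two Sx Sy) (here refl) = Sx
  gap-⊆ (two Sx Sy) (there (here refl)) = Sy

  module _ {S S′ : Fin n → Bool} (sd : Side S) (sd′ : Side S′) (disjoint : ∀ {z} → S z ≡ true → S′ z ≡ true → ⊥) where

    v∉gaps : ∀ {d d′} → Gap S d → Gap S′ d′ → v ∉ d ++ d′
    v∉gaps {d} g g′ v∈ with ∈-++⁻ d v∈
    ... | inj₁ p = ≢v sd (gap-⊆ g p) refl
    ... | inj₂ p = ≢v sd′ (gap-⊆ g′ p) refl

    -- The sides do not interact: the walk that exhibits `x` on the frontier stays in its own side
    -- and `v`, where deletions on the other side are invisible.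
    gaps-frontier : ∀ {d d′} → Gap S d → Gap S′ d′ → ∀ {x} → x ∈ d ++ d′ → Frontier (comp (without (d ++ d′)) v) x
    gaps-frontier {d} {d′} g g′ x∈ with ∈-++⁻ d x∈
    ... | inj₁ p = gap-frontier sd g (v∉gaps g g′) ∈-++⁺ˡ back p
      where
      back : ∀ {z} → S z ≡ true → z ∈ d ++ d′ → z ∈ d
      back Sz z∈ with ∈-++⁻ d z∈
      ... | inj₁ q = q
      ... | inj₂ q = ⊥-elim (disjoint Sz (gap-⊆ g′ q))
    ... | inj₂ p = gap-frontier sd′ g′ (v∉gaps g g′) (∈-++⁺ʳ d) back p
      where
      back : ∀ {z} → S′ z ≡ true → z ∈ d ++ d′ → z ∈ d′
      back Sz z∈ with ∈-++⁻ d z∈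
      ... | inj₁ q = ⊥-elim (disjoint (gap-⊆ g q) Sz)
      ... | inj₂ q = q

    -- All deleted vertices lie on the frontier of the common component, hence are deleted in the
    -- other description as well; disjointness then sorts them by side.
    gaps-recover : ∀ {d d′ e e′} → Gap S d → Gap S′ d′ → Gap S e → Gap S′ e′ →
      (∀ z → comp (without (d ++ d′)) v z ≡ comp (without (e ++ e′)) v z) →
      (∀ z → z ∈ d → z ∈ e) × (∀ z → z ∈ d′ → z ∈ e′)
    gaps-recover {d} {d′} {e} {e′} g g′ h h′ eq = left , right
      where
      total : ∀ {z} → z ∈ d ++ d′ → z ∈ e ++ e′
      total z∈ = without-false⁻ (frontier-removed (without⁺ (v∉gaps h h′)) (frontier-cong eq (gaps-frontier g g′ z∈)))
      left : ∀ z → z ∈ d → z ∈ e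
      left z z∈ with ∈-++⁻ e (total (∈-++⁺ˡ z∈))
      ... | inj₁ p = p
      ... | inj₂ p = ⊥-elim (disjoint (gap-⊆ g z∈) (gap-⊆ h′ p))
      right : ∀ z → z ∈ d′ → z ∈ e′
      right z z∈ with ∈-++⁻ e (total (∈-++⁺ʳ d z∈))
      ... | inj₁ p = ⊥-elim (disjoint (gap-⊆ h p) (gap-⊆ g′ z∈))
      ... | inj₂ p = p

    -- This makes room for deleting an edge: with no gap in `S`, both ends of every edge of the
    -- block are present.
    without-⊇ : ∀ {d′} → Gap S′ d′ → ∀ {z} → with-v S z ≡ true → comp (without d′) v z ≡ true
    without-⊇ {d′} g′ hz with with-v⁻ hz
    ... | inj₁ refl = comp⁺ here
    ... | inj₂ Sz = comp⁺ (induced-mono sub (side-connected sd Sz))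
      where
      sub : ∀ z → with-v S z ≡ true → without d′ z ≡ true
      sub z h with with-v⁻ h
      ... | inj₁ refl = without⁺ λ p → ≢v sd′ (gap-⊆ g′ p) refl
      ... | inj₂ Sz = without⁺ λ p → disjoint Sz (gap-⊆ g′ p)

-- Degree sums

fibres : (X → List Y) → List X → List (X × Y)
fibres f []       = []
fibres f (x ∷ xs) = map (x ,_) (f x) ++ fibres f xs

∈-fibres⁺ : ∀ {f : X → List Y} {xs x y} → x ∈ xs → y ∈ f x → (x , y) ∈ fibres f xs
∈-fibres⁺ (here refl) q = ∈-++⁺ˡ (∈-map⁺ _ q)
∈-fibres⁺ {f = f} {z ∷ _} (there p) q = ∈-++⁺ʳ (map (z ,_) (f z)) (∈-fibres⁺ p q)

∈-fibres⁻ : ∀ {f : X → List Y} xs {x y} → (x , y) ∈ fibres f xs → x ∈ xs × y ∈ f x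
∈-fibres⁻ {f = f} (z ∷ zs) p with ∈-++⁻ (map (z ,_) (f z)) p
... | inj₂ q = let a , b = ∈-fibres⁻ zs q in there a , b
... | inj₁ q with ∈-map⁻ (z ,_) q
...   | _ , y∈ , refl = here refl , y∈

fibres-Unique : ∀ {f : X → List Y} {xs} → Unique xs → (∀ x → Unique (f x)) → Unique (fibres f xs)
fibres-Unique [] _ = []
fibres-Unique {f = f} {x ∷ xs} (x≢ ∷ u) uf =
  Unique.++⁺ (map-Unique (x ,_) (uf x) λ { _ _ refl → refl }) (fibres-Unique u uf) (λ { (p , q) → disj p q })
  where
  disj : ∀ {p} → p ∈ map (x ,_) (f x) → p ∈ fibres f xs → ⊥
  disj p q with ∈-map⁻ (x ,_) p
  ... | _ , _ , refl = All.lookup x≢ (proj₁ (∈-fibres⁻ xs q)) refl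

length-fibres-≥ : ∀ {f : X → List Y} {k} xs → (∀ {x} → x ∈ xs → k ≤ length (f x)) → length xs * k ≤ length (fibres f xs)
length-fibres-≥ [] h = z≤n
length-fibres-≥ {f = f} {k} (x ∷ xs) h = begin
  k + length xs * k                                 ≤⟨ +-mono-≤ (h (here refl)) (length-fibres-≥ xs (h ∘ there)) ⟩
  length (f x) + length (fibres f xs)               ≡⟨ cong (_+ length (fibres f xs)) (sym (length-map (x ,_) (f x))) ⟩
  length (map (x ,_) (f x)) + length (fibres f xs)  ≡⟨ sym (length-++ (map (x ,_) (f x))) ⟩
  length (fibres f (x ∷ xs))                        ∎
  where open ≤-Reasoning

length-fibres-> : ∀ {f : X → List Y} {k} xs → (∀ {x} → x ∈ xs → k ≤ length (f x)) →
                  ∀ {z} → z ∈ xs → k < length (f z) → length xs * k < length (fibres f xs)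
length-fibres-> {f = f} {k} (x ∷ xs) h {z} z∈ k< = begin-strict
  k + length xs * k                                 <⟨ bound z∈ ⟩
  length (f x) + length (fibres f xs)               ≡⟨ cong (_+ length (fibres f xs)) (sym (length-map (x ,_) (f x))) ⟩
  length (map (x ,_) (f x)) + length (fibres f xs)  ≡⟨ sym (length-++ (map (x ,_) (f x))) ⟩
  length (fibres f (x ∷ xs))                        ∎
  where
  open ≤-Reasoning
  bound : z ∈ x ∷ xs → k + length xs * k < length (f x) + length (fibres f xs)
  bound (here refl) = +-mono-<-≤ k< (length-fibres-≥ xs (h ∘ there))
  bound (there p)   = +-mono-≤-< (h (here refl)) (length-fibres-> xs (h ∘ there) p k<)

-- The block spanned by v and one component of G - v

module Block {n : ℕ} (G : Graph n) (conn : Connected G) (v : Fin n)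
  (noncut : ∀ x → x ≢ v → ∀ u w → u ≢ x → w ≢ x → Reach (DeleteAdj G x) u w)
  (x₀ y₀ : Fin n) (x₀≢v : x₀ ≢ v) (y₀≢v : y₀ ≢ v) (x₀y₀ : adj G x₀ y₀ ≡ true) where

  open Sides G conn v noncut public

  abstract
    lA : List (Fin n)
    lA = proj₁ (component (DeleteAdj G v) x₀)

    growA : Grow (DeleteAdj G v) x₀ lA
    growA = proj₁ (proj₂ (component (DeleteAdj G v) x₀))

    closedA : Closed (DeleteAdj G v) lA
    closedA = proj₂ (proj₂ (component (DeleteAdj G v) x₀))

  lA! : Unique lA
  lA! = grow-Unique growA

  inA : Fin n → Bool
  inA = member lA

  ∈A⇒≢v : ∀ {z} → z ∈ lA → z ≢ v
  ∈A⇒≢v z∈ = reach-closed (_≢ v) (λ i j e _ → proj₂ (proj₂ (DeleteAdj⁻ e))) (grow-reach growA z∈) x₀≢v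

  A-reach : ∀ {x y} → x ∈ lA → y ∈ lA → Reach (DeleteAdj G v) x y
  A-reach x∈ y∈ = reach-trans (reach-sym swap (grow-reach growA x∈)) (grow-reach growA y∈)
    where
    swap : ∀ i j → DeleteAdj G v i j ≡ true → DeleteAdj G v j i ≡ true
    swap i j e = let a , b , c = DeleteAdj⁻ e in DeleteAdj⁺ (adj-swap i j a) c b

  x₀∈A : x₀ ∈ lA
  x₀∈A = grow-root growA

  y₀∈A : y₀ ∈ lA
  y₀∈A = closedA x₀ y₀ x₀∈A (DeleteAdj⁺ x₀y₀ x₀≢v y₀≢v)

  other : ∀ x → ∃ λ z → z ∈ lA × z ≢ x
  other x with x₀ ≟ x
  ... | no x₀≢x  = x₀ , x₀∈A , x₀≢x
  ... | yes refl = y₀ , y₀∈A , adj⇒≢ (adj-swap x₀ y₀ x₀y₀)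

  2≤a : 2 ≤ length lA
  2≤a = length-⊆ {xs = x₀ ∷ y₀ ∷ []} ((adj⇒≢ x₀y₀ ∷ []) ∷ ([] ∷ []))
    λ { (here refl) → x₀∈A ; (there (here refl)) → y₀∈A }

  sideA : Side inA
  sideA .v∉ = nonmember⁺ λ v∈ → ∈A⇒≢v v∈ refl
  sideA .exits {i} {j} e Ai with j ≟ v
  ... | yes j≡v = inj₂ j≡v
  ... | no j≢v  = inj₁ (member⁺ (closedA i j (member⁻ Ai) (DeleteAdj⁺ e (∈A⇒≢v (member⁻ Ai)) j≢v)))

  lR : List (Fin n)
  lR = filter (λ z → ¬? (z ≟ v) ×-dec ¬? (z ∈F? lA)) (allFin n)

  ∈R⁻ : ∀ {z} → z ∈ lR → z ≢ v × z ∉ lA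
  ∈R⁻ z∈ = proj₂ (∈-filter⁻ (λ z → ¬? (z ≟ v) ×-dec ¬? (z ∈F? lA)) {xs = allFin n} z∈)

  ∈R⁺ : ∀ {z} → z ≢ v → z ∉ lA → z ∈ lR
  ∈R⁺ {z} a b = ∈-filter⁺ (λ z → ¬? (z ≟ v) ×-dec ¬? (z ∈F? lA)) (∈-allFin z) (a , b)

  lR! : Unique lR
  lR! = Unique.filter⁺ (λ z → ¬? (z ≟ v) ×-dec ¬? (z ∈F? lA)) (Unique.allFin⁺ n)

  inR : Fin n → Bool
  inR = member lR

  disjoint : ∀ {z} → inA z ≡ true → inR z ≡ true → ⊥
  disjoint a r = proj₂ (∈R⁻ (member⁻ r)) (member⁻ a)

  sideR : Side inR
  sideR .v∉ = nonmember⁺ λ v∈ → proj₁ (∈R⁻ v∈) refl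
  sideR .exits {i} {j} e Ri with j ≟ v
  ... | yes j≡v = inj₂ j≡v
  ... | no j≢v  = inj₁ (member⁺ (∈R⁺ j≢v λ j∈ → [ (λ Ai → disjoint Ai Ri) , proj₁ (∈R⁻ (member⁻ Ri)) ] (exits sideA (adj-swap i j e) (member⁺ j∈))))

  cases : ∀ z → z ≡ v ⊎ z ∈ lA ⊎ z ∈ lR
  cases z with z ≟ v | z ∈F? lA
  ... | yes p | _ = inj₁ p
  ... | no _ | yes q = inj₂ (inj₁ q)
  ... | no p | no q = inj₂ (inj₂ (∈R⁺ p q))

  vertices : length lA + length lR + 1 ≡ n
  vertices = trans (+-comm (length lA + length lR) 1) (trans (cong suc (sym (length-++ lA)))
    (≤-antisym (length-Unique-≤ (v ∷ lA ++ lR) uniq)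
      (subst (_≤ length (v ∷ lA ++ lR)) (length-tabulate {n = n} id) (length-⊆ (Unique.allFin⁺ n) (λ {z} _ → cover z)))))
    where
    v∉AR : v ∉ lA ++ lR
    v∉AR p with ∈-++⁻ lA p
    ... | inj₁ q = ∈A⇒≢v q refl
    ... | inj₂ q = proj₁ (∈R⁻ q) refl
    uniq : Unique (v ∷ lA ++ lR)
    uniq = ∉⇒All≢ v∉AR ∷ Unique.++⁺ lA! lR! (λ { (p , q) → proj₂ (∈R⁻ q) p })
    cover : ∀ z → z ∈ v ∷ lA ++ lR
    cover z with cases z
    ... | inj₁ refl = here refl
    ... | inj₂ (inj₁ q) = there (∈-++⁺ˡ q)
    ... | inj₂ (inj₂ q) = there (∈-++⁺ʳ lA q)

  inB : Fin n → Bool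
  inB = with-v inA

  lB : List (Fin n)
  lB = v ∷ lA

  lB! : Unique lB
  lB! = ∉⇒All≢ (λ v∈ → ∈A⇒≢v v∈ refl) ∷ lA!

  inB⇒∈ : ∀ {z} → inB z ≡ true → z ∈ lB
  inB⇒∈ h with with-v⁻ h
  ... | inj₁ refl = here refl
  ... | inj₂ q    = there (member⁻ q)

  ∈⇒inB : ∀ {z} → z ∈ lB → inB z ≡ true
  ∈⇒inB (here refl) = with-v-v
  ∈⇒inB (there p)   = with-v⁺ (member⁺ p)

  neighbour : ∀ {u} → inB u ≡ true → ∃ λ w → inB w ≡ true × adj G u w ≡ true
  neighbour {u} hu with with-v⁻ hu
  ... | inj₂ Au = let w , e = reach-first (conn u v) (≢v sideA Au) in w , side-exits sideA e Au , e
  ... | inj₁ refl = let w , e = reach-first (side-connected sideA (member⁺ x₀∈A)) (x₀≢v ∘ sym)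
                        a , _ , c = induced⁻ e in w , c , a

  -- Take the first step of a walk from `u` that avoids `j`. Its target is `v` when `u` lies in A
  -- and `j` is not `v`; otherwise it is a further vertex of A, from `other`. For `u` equal to `v`
  -- the walk is confined to the block, since it could otherwise start into R.
  second-neighbour : ∀ {u j} → inB u ≡ true → inB j ≡ true → adj G u j ≡ true →
                     ∃ λ w → w ≢ j × inB w ≡ true × adj G u w ≡ true
  second-neighbour {u} {j} hu hj e with with-v⁻ hu | j ≟ v
  ... | inj₂ Au | no j≢v =
    let w , d = reach-first (noncut j j≢v u v (adj⇒≢ e) (j≢v ∘ sym)) (≢v sideA Au)
        a , _ , w≢j = DeleteAdj⁻ d
    in w , w≢j , side-exits sideA a Au , a
  ... | inj₂ Au | yes refl =
    let z , z∈ , z≢u = other u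
        w , d = reach-first (A-reach (member⁻ Au) z∈) (z≢u ∘ sym)
        a , _ , w≢v = DeleteAdj⁻ d
    in w , w≢v , side-exits sideA a Au , a
  ... | inj₁ refl | yes refl = ⊥-elim (adj⇒≢ e refl)
  ... | inj₁ refl | no j≢v with with-v⁻ hj
  ...   | inj₁ j≡v = ⊥-elim (j≢v j≡v)
  ...   | inj₂ Aj =
    let z , z∈ , z≢j = other j
        w , d = reach-first (side-avoid sideA Aj (j≢v ∘ sym) z≢j with-v-v (with-v⁺ (member⁺ z∈))) (∈A⇒≢v z∈ ∘ sym)
        d′ , _ , hw = restrict⁻ d
        a , _ , w≢j = DeleteAdj⁻ d′
    in w , w≢j , hw , a

  Nbr : Fin n → Fin n → Set
  Nbr u w = inB w ≡ true × adj G u w ≡ true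

  nbr? : ∀ u w → Dec (Nbr u w)
  nbr? u w = (inB w Bool.≟ true) ×-dec (adj G u w Bool.≟ true)

  nbrs : Fin n → List (Fin n)
  nbrs u = filter (nbr? u) (allFin n)

  ∈-nbrs⁺ : ∀ {u w} → Nbr u w → w ∈ nbrs u
  ∈-nbrs⁺ {u} {w} = ∈-filter⁺ (nbr? u) (∈-allFin w)

  ∈-nbrs⁻ : ∀ {u w} → w ∈ nbrs u → Nbr u w
  ∈-nbrs⁻ {u} p = proj₂ (∈-filter⁻ (nbr? u) {xs = allFin n} p)

  2≤degree : ∀ {u} → u ∈ lB → 2 ≤ length (nbrs u)
  2≤degree u∈ with neighbour (∈⇒inB u∈)
  ... | j , hj , e with second-neighbour (∈⇒inB u∈) hj e
  ...   | w , w≢j , hw , e′ = length-⊆ {xs = w ∷ j ∷ []} ((w≢j ∷ []) ∷ ([] ∷ []))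
    λ { (here refl) → ∈-nbrs⁺ (hw , e′) ; (there (here refl)) → ∈-nbrs⁺ (hj , e) }

  darts : List (Fin n × Fin n)
  darts = fibres nbrs lB

  ∈-darts⁻ : ∀ {i j} → (i , j) ∈ darts → inB i ≡ true × inB j ≡ true × adj G i j ≡ true
  ∈-darts⁻ p = let a , b = ∈-fibres⁻ lB p in ∈⇒inB a , ∈-nbrs⁻ b

  ∈-darts⁺ : ∀ {i j} → inB i ≡ true → inB j ≡ true → adj G i j ≡ true → (i , j) ∈ darts
  ∈-darts⁺ hi hj e = ∈-fibres⁺ (inB⇒∈ hi) (∈-nbrs⁺ (hj , e))

  ascending? : (p : Fin n × Fin n) → Dec (proj₁ p Fin.< proj₂ p)
  ascending? (i , j) = i Fin.<? j

  edges : List (Fin n × Fin n)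
  edges = filter ascending? darts

  darts! : Unique darts
  darts! = fibres-Unique lB! (λ u → Unique.filter⁺ (nbr? u) (Unique.allFin⁺ n))

  edges! : Unique edges
  edges! = Unique.filter⁺ ascending? darts!

  ∈-edges⁻ : ∀ {i j} → (i , j) ∈ edges → inB i ≡ true × inB j ≡ true × adj G i j ≡ true × i Fin.< j
  ∈-edges⁻ p = let a , b = ∈-filter⁻ ascending? {xs = darts} p ; c , d , e = ∈-darts⁻ a in c , d , e , b

  handshake : length darts ≤ length edges * 2
  handshake = subst (length darts ≤_) len (length-⊆ darts! (λ {p} p∈ → cover (proj₁ p) (proj₂ p) p∈))
    where
    swapped : List (Fin n × Fin n)
    swapped = map (λ p → proj₂ p , proj₁ p) edges
    len : length (edges ++ swapped) ≡ length edges * 2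
    len = trans (length-++ edges) (trans (cong (length edges +_) (length-map _ edges))
      (trans (cong (length edges +_) (sym (+-identityʳ (length edges)))) (*-comm 2 (length edges))))
    cover : ∀ i j → (i , j) ∈ darts → (i , j) ∈ edges ++ swapped
    cover i j p with Fin.<-cmp i j
    ... | tri< i<j _ _ = ∈-++⁺ˡ (∈-filter⁺ ascending? p i<j)
    ... | tri≈ _ refl _ = ⊥-elim (adj⇒≢ (proj₂ (proj₂ (∈-darts⁻ p))) refl)
    ... | tri> _ _ j<i = let hi , hj , e = ∈-darts⁻ p in
      ∈-++⁺ʳ edges (∈-map⁺ (λ p → proj₂ p , proj₁ p) (∈-filter⁺ ascending? (∈-darts⁺ hj hi (adj-swap i j e)) j<i))

  -- The `a + 1` vertices of the block have degree at least 2 in it, so there are at least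
  -- `2 (a + 1)` darts. A vertex of degree 3 makes this strict, so equality leaves a 2-regular
  -- block.
  edges-≥ : suc (length lA) ≤ length edges
  edges-≥ = *-cancelʳ-≤ (suc (length lA)) (length edges) 2 (≤-trans (length-fibres-≥ {f = nbrs} lB 2≤degree) handshake)

  edges-> : ∀ {u} → u ∈ lB → 3 ≤ length (nbrs u) → suc (length lA) < length edges
  edges-> u∈ h = *-cancelʳ-< 2 (suc (length lA)) (length edges) (<-≤-trans (length-fibres-> {f = nbrs} lB 2≤degree u∈ h) handshake)

-- Lower bound on the number of connected subgraphs

module LowerBound {n : ℕ} (G : Graph n) (conn : Connected G) (v : Fin n)
  (noncut : ∀ x → x ≢ v → ∀ u w → u ≢ x → w ≢ x → Reach (DeleteAdj G x) u w)
  (x₀ y₀ : Fin n) (x₀≢v : x₀ ≢ v) (y₀≢v : y₀ ≢ v) (x₀y₀ : adj G x₀ y₀ ≡ true) where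

  open Block G conn v noncut x₀ y₀ x₀≢v y₀≢v x₀y₀ public

  abstract
    deleted : Maybe (Fin n × Fin n) → EdgeRel n
    deleted nothing        a b = false
    deleted (just (i , j)) a b = does (a ≟ i) ∧ does (b ≟ j) ∨ does (a ≟ j) ∧ does (b ≟ i)

    deleted-nothing : ∀ {a b} → deleted nothing a b ≡ true → ⊥
    deleted-nothing ()

    deleted⁻ : ∀ {i j a b} → deleted (just (i , j)) a b ≡ true → (a ≡ i × b ≡ j) ⊎ (a ≡ j × b ≡ i)
    deleted⁻ {i} {j} {a} {b} h with ∨-true {does (a ≟ i) ∧ does (b ≟ j)} h
    ... | inj₁ p = let q , r = ∧-true p in inj₁ (does-true (a ≟ i) q , does-true (b ≟ j) r)
    ... | inj₂ p = let q , r = ∧-true p in inj₂ (does-true (a ≟ j) q , does-true (b ≟ i) r)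

    deleted-self : ∀ {i j} → deleted (just (i , j)) i j ≡ true
    deleted-self {i} {j} = cong (_∨ (does (i ≟ j) ∧ does (j ≟ i))) (∧-true⁺ (dec-true (i ≟ i) refl) (dec-true (j ≟ j) refl))

    deleted-flip : ∀ {i j} → deleted (just (i , j)) j i ≡ true
    deleted-flip {i} {j} = ∨-trueʳ (does (j ≟ i) ∧ does (i ≟ j)) (∧-true⁺ (dec-true (j ≟ j) refl) (dec-true (i ≟ i) refl))

  deleted-sym : ∀ k a b → deleted k a b ≡ true → deleted k b a ≡ true
  deleted-sym nothing a b h = ⊥-elim (deleted-nothing h)
  deleted-sym (just (i , j)) a b h with deleted⁻ h
  ... | inj₁ (refl , refl) = deleted-flip
  ... | inj₂ (refl , refl) = deleted-self

  abstract
    kept : (Fin n → Bool) → Maybe (Fin n × Fin n) → EdgeRel n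
    kept U k a b = induced U a b ∧ not (deleted k a b)

    kept⁺ : ∀ {U k a b} → induced U a b ≡ true → (deleted k a b ≡ true → ⊥) → kept U k a b ≡ true
    kept⁺ e ¬d = ∧-true⁺ e (not-true⁺ (≢true⇒false ¬d))

    kept⁻ : ∀ {U k a b} → kept U k a b ≡ true → induced U a b ≡ true × (deleted k a b ≡ true → ⊥)
    kept⁻ h = let e , d = ∧-true h in e , λ d′ → true≢false d′ (not-true d)

  kept-sym : ∀ U k a b → kept U k a b ≡ true → kept U k b a ≡ true
  kept-sym U k a b h = let e , ¬d = kept⁻ h in kept⁺ (induced-sym U a b e) (¬d ∘ deleted-sym k b a)

  -- A block has no bridge: leave i through a second neighbour and return to j avoiding i.
  detour-from : ∀ {i j k} → (∀ a b → deleted k a b ≡ true → (a ≡ i × b ≡ j) ⊎ (a ≡ j × b ≡ i)) →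
                inA i ≡ true → inB j ≡ true → adj G i j ≡ true → Reach (kept inB k) i j
  detour-from {i} {j} {k} only Ai hj e =
    let w , w≢j , hw , e′ = second-neighbour (with-v⁺ Ai) hj e
    in step (kept⁺ (induced⁺ e′ (with-v⁺ Ai) hw) (λ d → [ (λ p → w≢j (proj₂ p)) , (λ p → adj⇒≢ e (proj₁ p)) ] (only i w d)))
            (reach-map ok (side-avoid sideA Ai (adj⇒≢ e′ ∘ sym) (adj⇒≢ e ∘ sym) hw hj))
    where
    ok : ∀ a b → restrict (DeleteAdj G i) inB a b ≡ true → kept inB k a b ≡ true
    ok a b h = let d , ha , hb = restrict⁻ h ; f , a≢i , b≢i = DeleteAdj⁻ d in
      kept⁺ (induced⁺ f ha hb) (λ d′ → [ (λ p → a≢i (proj₁ p)) , (λ p → b≢i (proj₂ p)) ] (only a b d′))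

  detour : ∀ {i j} → inB i ≡ true → inB j ≡ true → adj G i j ≡ true → Reach (kept inB (just (i , j))) i j
  detour {i} {j} hi hj e with with-v⁻ hi | with-v⁻ hj
  ... | inj₂ Ai | _ = detour-from (λ a b → deleted⁻) Ai hj e
  ... | inj₁ refl | inj₂ Aj = reach-sym (kept-sym inB _)
    (detour-from (λ a b d → [ inj₂ , inj₁ ] (deleted⁻ d)) Aj hi (adj-swap i j e))
  ... | inj₁ refl | inj₁ refl = ⊥-elim (adj⇒≢ e refl)

  -- `inj₁` leaves A intact and drops at most one edge of the block; `inj₂` deletes the entries of a
  -- pair in A. The choices in B and R are independent, which produces the product in the bound.
  BCode RCode : Set
  BCode = Maybe (Fin n × Fin n) ⊎ (Fin n × Fin n)
  RCode = Maybe (Fin n × Fin n)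

  gapB : BCode → List (Fin n)
  gapB (inj₁ _) = []
  gapB (inj₂ p) = both p

  edgeB : BCode → Maybe (Fin n × Fin n)
  edgeB (inj₁ k) = k
  edgeB (inj₂ _) = nothing

  gapR : RCode → List (Fin n)
  gapR nothing  = []
  gapR (just p) = both p

  codesB : List BCode
  codesB = map inj₁ (nothing ∷ map just edges) ++ map inj₂ (pairs lA)

  codesR : List RCode
  codesR = nothing ∷ map just (pairs lR)

  data ValidB : BCode → Set where
    whole : ValidB (inj₁ nothing)
    minus : ∀ {p} → p ∈ edges → ValidB (inj₁ (just p))
    gap   : ∀ {p} → p ∈ pairs lA → ValidB (inj₂ p)

  data ValidR : RCode → Set where
    whole : ValidR nothing
    gap   : ∀ {p} → p ∈ pairs lR → ValidR (just p)

  validB : ∀ {c} → c ∈ codesB → ValidB c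
  validB c∈ with ∈-++⁻ (map inj₁ (nothing ∷ map just edges)) c∈
  validB c∈ | inj₁ (here refl) = whole
  validB c∈ | inj₁ (there p) with ∈-map⁻ inj₁ p
  ... | _ , q , refl with ∈-map⁻ just q
  ...   | _ , r , refl = minus r
  validB c∈ | inj₂ p with ∈-map⁻ inj₂ p
  ... | _ , q , refl = gap q

  validR : ∀ {c} → c ∈ codesR → ValidR c
  validR (here refl) = whole
  validR (there p) with ∈-map⁻ just p
  ... | _ , q , refl = gap q

  both-gap : ∀ {l p} → p ∈ pairs l → Gap (member l) (both p)
  both-gap {l} p∈ = let a , b = pairs-∈ l p∈ in two (member⁺ a) (member⁺ b)

  validB-gap : ∀ {c} → ValidB c → Gap inA (gapB c)
  validB-gap whole     = none
  validB-gap (minus _) = none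
  validB-gap (gap p)   = both-gap p

  validR-gap : ∀ {c} → ValidR c → Gap inR (gapR c)
  validR-gap whole   = none
  validR-gap (gap p) = both-gap p

  -- The set U_D, for the D given by the two gaps.
  reached : BCode × RCode → Fin n → Bool
  reached (c , d) = comp (without (gapB c ++ gapR d)) v

  through : BCode × RCode → SubG n
  through (c , d) = subgraph (reached (c , d)) (kept (reached (c , d)) (edgeB c))

  codes : List (BCode × RCode)
  codes = cartesianProduct codesB codesR

  widen : ∀ {d} → ValidR d → ∀ p a b → kept inB (just p) a b ≡ true → kept (reached (inj₁ (just p) , d)) (just p) a b ≡ true
  widen vd p a b h = let g , ¬d = kept⁻ h ; x , y , z = induced⁻ g in
    kept⁺ (induced⁺ x (without-⊇ sideA sideR disjoint (validR-gap vd) y) (without-⊇ sideA sideR disjoint (validR-gap vd) z)) ¬d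

  through-connected : ∀ {c d} → ValidB c → ValidR d → IsConnSubgraph G (through (c , d))
  through-connected {c} {d} vc vd =
    subgraph-connected G v (λ i j h → induced⁻ (proj₁ (kept⁻ h))) (kept-sym (reached (c , d)) (edgeB c)) (comp⁺ here)
      (λ z cz → reach-bind id (λ i j e → keep vc i j e) (comp-connected cz))
    where
    keep : ∀ {c} → ValidB c → ∀ i j → induced (reached (c , d)) i j ≡ true → Reach (kept (reached (c , d)) (edgeB c)) i j
    keep whole   i j e = reach-edge (kept⁺ e deleted-nothing)
    keep (gap _) i j e = reach-edge (kept⁺ e deleted-nothing)
    keep {c} (minus {p} p∈) i j e with deleted (just p) i j Bool.≟ true
    ... | no ¬d = reach-edge (kept⁺ e ¬d)
    ... | yes dl with ∈-edges⁻ p∈ | deleted⁻ dl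
    -- The gap lies in R here, so the whole block is in U_D and the detour around the dropped edge
    -- survives.
    ...   | hi , hj , f , _ | inj₁ (refl , refl) = reach-map (widen vd p) (detour hi hj f)
    ...   | hi , hj , f , _ | inj₂ (refl , refl) = reach-sym (kept-sym _ _) (reach-map (widen vd p) (detour hi hj f))

  -- Both ends of `p` are in U_D for either code, so the absence of this edge from the second
  -- subgraph can only be due to `k`.
  missing : ∀ {p k d} → ValidR d → p ∈ edges → through (inj₁ (just p) , d) ≡ through (inj₁ k , d) →
            deleted k (proj₁ p) (proj₂ p) ≡ true
  missing {i , j} {k} {d} vd p∈ eq with deleted k i j Bool.≟ true
  ... | yes h = h
  ... | no ¬h = ⊥-elim (proj₂ (kept⁻ (trans (proj₂ (subgraph-injective eq) i j) (kept⁺ ind ¬h))) deleted-self)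
    where
    ind : induced (reached (inj₁ k , d)) i j ≡ true
    ind = let hi , hj , e , _ = ∈-edges⁻ p∈ in
      induced⁺ e (without-⊇ sideA sideR disjoint (validR-gap vd) hi) (without-⊇ sideA sideR disjoint (validR-gap vd) hj)

  sameB : ∀ {c c′ d} → ValidB c → ValidB c′ → ValidR d → through (c , d) ≡ through (c′ , d) →
          (∀ z → z ∈ gapB c → z ∈ gapB c′) → (∀ z → z ∈ gapB c′ → z ∈ gapB c) → c ≡ c′
  sameB whole whole vd eq s t = refl
  sameB whole (minus p) vd eq s t = ⊥-elim (deleted-nothing (missing vd p (sym eq)))
  sameB whole (gap p) vd eq s t with t _ (here refl)
  ... | ()
  sameB (minus p) whole vd eq s t = ⊥-elim (deleted-nothing (missing vd p eq))
  sameB (minus p) (gap q) vd eq s t with t _ (here refl)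
  ... | ()
  sameB (gap p) whole vd eq s t with s _ (here refl)
  ... | ()
  sameB (gap p) (minus q) vd eq s t with s _ (here refl)
  ... | ()
  sameB (gap p) (gap q) vd eq s t = cong inj₂ (pairs-injective lA! p q s t)
  sameB (minus {i , j} p) (minus {k , l} q) vd eq s t with deleted⁻ (missing vd p eq)
  ... | inj₁ (refl , refl) = refl
  -- Edges are stored in ascending orientation, which excludes a reversed match.
  ... | inj₂ (refl , refl) = ⊥-elim (<-asym (proj₂ (proj₂ (proj₂ (∈-edges⁻ p)))) (proj₂ (proj₂ (proj₂ (∈-edges⁻ q)))))

  sameR : ∀ {d d′} → ValidR d → ValidR d′ → (∀ z → z ∈ gapR d → z ∈ gapR d′) → (∀ z → z ∈ gapR d′ → z ∈ gapR d) → d ≡ d′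
  sameR whole whole s t = refl
  sameR whole (gap p) s t with t _ (here refl)
  ... | ()
  sameR (gap p) whole s t with s _ (here refl)
  ... | ()
  sameR (gap p) (gap q) s t = cong just (pairs-injective lR! p q s t)

  through-injective : ∀ {c d c′ d′} → ValidB c → ValidR d → ValidB c′ → ValidR d′ →
                      through (c , d) ≡ through (c′ , d′) → (c , d) ≡ (c′ , d′)
  through-injective {c} {d} {c′} {d′} vc vd vc′ vd′ eq
    with gaps-recover sideA sideR disjoint (validB-gap vc) (validR-gap vd) (validB-gap vc′) (validR-gap vd′) (proj₁ (subgraph-injective eq))
       | gaps-recover sideA sideR disjoint (validB-gap vc′) (validR-gap vd′) (validB-gap vc) (validR-gap vd) (sym ∘ proj₁ (subgraph-injective eq))
  ... | s , s′ | t , t′ with sameR vd vd′ s′ t′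
  ...   | refl = cong (_, d) (sameB vc vc′ vd eq s t)

  codesB! : Unique codesB
  codesB! = Unique.++⁺
    (map-Unique inj₁ (All.map⁺ (All.tabulate λ _ ()) ∷ map-Unique just edges! λ { _ _ refl → refl }) λ { _ _ refl → refl })
    (map-Unique inj₂ (pairs-Unique lA!) λ { _ _ refl → refl })
    (λ { (p , q) → disj p q })
    where
    disj : ∀ {c} → c ∈ map inj₁ (nothing ∷ map just edges) → c ∈ map inj₂ (pairs lA) → ⊥
    disj p q with ∈-map⁻ inj₁ p | ∈-map⁻ inj₂ q
    ... | _ , _ , refl | _ , _ , ()

  codesR! : Unique codesR
  codesR! = All.map⁺ (All.tabulate λ _ ()) ∷ map-Unique just (pairs-Unique lR!) λ { _ _ refl → refl }

  single : Fin n → SubG n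
  single z = inducedSub (comp (member (z ∷ [])) z)

  single-vertex : ∀ {z w} → vertex (single z) w ≡ true → w ≡ z
  single-vertex {z} {w} h with member⁻ (comp-⊆ {member (z ∷ [])} {z} (member⁺ (here refl)) (trans (sym (vertex-subgraph (comp (member (z ∷ [])) z) (induced (comp (member (z ∷ [])) z)) w)) h))
  ... | here p = p

  single-self : ∀ z → vertex (single z) z ≡ true
  single-self z = trans (vertex-subgraph (comp (member (z ∷ [])) z) (induced (comp (member (z ∷ [])) z)) z) (comp⁺ here)

  witnesses : List (SubG n)
  witnesses = map through codes ++ rootedSubs lA ++ map single lR

  D⊆adj : ∀ i j → DeleteAdj G v i j ≡ true → adj G i j ≡ true
  D⊆adj i j d = proj₁ (DeleteAdj⁻ d)

  code-valid : ∀ {c d} → (c , d) ∈ codes → ValidB c × ValidR d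
  code-valid p = let a , b = ∈-cartesianProduct⁻ codesB codesR p in validB a , validR b

  through-v : ∀ {H} → H ∈ map through codes → vertex H v ≡ true
  through-v p with ∈-map⁻ through {xs = codes} p
  ... | (c , d) , _ , refl = trans (vertex-subgraph (reached (c , d)) (kept (reached (c , d)) (edgeB c)) v) (comp⁺ here)

  -- The three families are kept apart by their vertices: the first contain `v`, the second lie
  -- inside A, the third are single vertices of R.
  witnesses! : Unique witnesses
  witnesses! = Unique.++⁺
    (map-Unique through (Unique.cartesianProduct⁺ codesB! codesR!)
      (λ p q → let a , b = code-valid p ; a′ , b′ = code-valid q in through-injective a b a′ b′))
    (Unique.++⁺ (rootedSubs-Unique D⊆adj growA)
      (map-Unique single lR! λ { {x} {y} _ _ eq → single-vertex (subst (λ H → vertex H x ≡ true) eq (single-self x)) })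
      (λ { (p , q) → disj₁ p q }))
    (λ { (p , q) → disj₂ p (∈-++⁻ (rootedSubs lA) q) })
    where
    disj₁ : ∀ {H} → H ∈ rootedSubs lA → H ∈ map single lR → ⊥
    disj₁ p q with ∈-map⁻ single q
    ... | z , z∈ , refl = proj₂ (∈R⁻ z∈) (rootedSubs-⊆ lA! p z (single-self z))
    disj₂ : ∀ {H} → H ∈ map through codes → H ∈ rootedSubs lA ⊎ H ∈ map single lR → ⊥
    disj₂ p (inj₁ q) = ∈A⇒≢v (rootedSubs-⊆ lA! q v (through-v p)) refl
    disj₂ p (inj₂ q) with ∈-map⁻ single q
    ... | z , z∈ , refl = proj₁ (∈R⁻ z∈) (sym (single-vertex {z} {v} (through-v p)))

  witnesses-connected : All (IsConnSubgraph G) witnesses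
  witnesses-connected = All.++⁺
    (All.map⁺ (All.tabulate λ p → let a , b = code-valid p in through-connected a b))
    (All.++⁺ (rootedSubs-connected lA) (All.map⁺ (All.tabulate λ {z} _ → inducedSub-connected {member (z ∷ [])})))

  length-witnesses : length witnesses ≡
    (suc (length edges) + triangle (length lA)) * suc (triangle (length lR)) + (triangle (length lA) + length lR)
  length-witnesses = trans (length-++ (map through codes)) (cong₂ _+_
    (trans (length-map through codes) (trans (length-cartesianProduct codesB codesR) (cong₂ _*_
      (trans (length-++ (map inj₁ (nothing ∷ map just edges))) (cong₂ _+_
        (cong suc (trans (length-map inj₁ (map just edges)) (length-map just edges)))
        (trans (length-map inj₂ (pairs lA)) (length-pairs lA))))
      (cong suc (trans (length-map just (pairs lR)) (length-pairs lR))))))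
    (trans (length-++ (rootedSubs lA)) (cong₂ _+_ (length-rootedSubs lA) (length-map single lR))))

  F-≥ : ∀ {k} → F G k →
    (suc (length edges) + triangle (length lA)) * suc (triangle (length lR)) + (triangle (length lA) + length lR) ≤ k
  F-≥ {k} c = subst (_≤ k) length-witnesses (count-≥ c witnesses witnesses! witnesses-connected)

-- The graph L: the cycle 0, …, a with the pendant vertex a + 1 at 0

≡ᵇ-true⁻ : ∀ {x y} → (x ≡ᵇ y) ≡ true → x ≡ y
≡ᵇ-true⁻ {x} {y} h = ≡ᵇ⇒≡ x y (subst T (sym h) _)

≡ᵇ-true⁺ : ∀ {x y} → x ≡ y → (x ≡ᵇ y) ≡ true
≡ᵇ-true⁺ {zero} refl = refl
≡ᵇ-true⁺ {suc x} refl = ≡ᵇ-true⁺ {x} refl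

<ᵇ-true⁻ : ∀ {x y} → (x <ᵇ y) ≡ true → x < y
<ᵇ-true⁻ {x} {y} h = <ᵇ⇒< x y (subst T (sym h) _)

<ᵇ-true⁺ : ∀ {x y} → x < y → (x <ᵇ y) ≡ true
<ᵇ-true⁺ {x} {y} h with x <ᵇ y | <⇒<ᵇ h
... | true | _ = refl

data LEdge (a : ℕ) : ℕ → ℕ → Set where
  up      : ∀ {x} → x < a → LEdge a x (suc x)
  down    : ∀ {x} → x < a → LEdge a (suc x) x
  wrap    : LEdge a a 0
  unwrap  : LEdge a 0 a
  pend    : LEdge a 0 (suc a)
  unpend  : LEdge a (suc a) 0

abstract
  ladj : ℕ → ℕ → ℕ → Bool
  ladj a x y =
    ((x <ᵇ suc a) ∧ (y <ᵇ suc a) ∧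
       ((suc x ≡ᵇ y) ∨ (suc y ≡ᵇ x) ∨ ((x ≡ᵇ 0) ∧ (suc y ≡ᵇ suc a)) ∨ ((y ≡ᵇ 0) ∧ (suc x ≡ᵇ suc a))))
    ∨ ((x ≡ᵇ suc a) ∧ (y ≡ᵇ 0)) ∨ ((y ≡ᵇ suc a) ∧ (x ≡ᵇ 0))

  LAdj-ladj : ∀ a (i j : Fin (2 + a)) → LAdj (2 + a) i j ≡ ladj a (toℕ i) (toℕ j)
  LAdj-ladj a i j = refl

  ladj⇒LEdge : ∀ {a x y} → ladj a x y ≡ true → LEdge a x y
  ladj⇒LEdge {a} {x} {y} h = [ cycle , pendant ] (∨-true {(x <ᵇ suc a) ∧ _} h)
    where
    pendant : ((x ≡ᵇ suc a) ∧ (y ≡ᵇ 0)) ∨ ((y ≡ᵇ suc a) ∧ (x ≡ᵇ 0)) ≡ true → LEdge a x y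
    pendant h with ∨-true {(x ≡ᵇ suc a) ∧ (y ≡ᵇ 0)} h
    ... | inj₁ e = let p , r = ∧-true {x ≡ᵇ suc a} e in subst₂ (LEdge a) (sym (≡ᵇ-true⁻ {x} p)) (sym (≡ᵇ-true⁻ {y} r)) unpend
    ... | inj₂ e = let p , r = ∧-true {y ≡ᵇ suc a} e in subst₂ (LEdge a) (sym (≡ᵇ-true⁻ {x} r)) (sym (≡ᵇ-true⁻ {y} p)) pend
    wrapped : ((x ≡ᵇ 0) ∧ (suc y ≡ᵇ suc a)) ∨ ((y ≡ᵇ 0) ∧ (suc x ≡ᵇ suc a)) ≡ true → LEdge a x y
    wrapped h with ∨-true {(x ≡ᵇ 0) ∧ (suc y ≡ᵇ suc a)} h
    ... | inj₁ e = let p , r = ∧-true {x ≡ᵇ 0} e in subst₂ (LEdge a) (sym (≡ᵇ-true⁻ {x} p)) (sym (≡ᵇ-true⁻ {y} r)) unwrap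
    ... | inj₂ e = let p , r = ∧-true {y ≡ᵇ 0} e in subst₂ (LEdge a) (sym (≡ᵇ-true⁻ {x} r)) (sym (≡ᵇ-true⁻ {y} p)) wrap
    cycle : (x <ᵇ suc a) ∧ (y <ᵇ suc a) ∧
            ((suc x ≡ᵇ y) ∨ (suc y ≡ᵇ x) ∨ ((x ≡ᵇ 0) ∧ (suc y ≡ᵇ suc a)) ∨ ((y ≡ᵇ 0) ∧ (suc x ≡ᵇ suc a))) ≡ true → LEdge a x y
    cycle h with ∧-true {x <ᵇ suc a} h
    ... | x< , h′ with ∧-true {y <ᵇ suc a} h′
    ...   | y< , h″ with ∨-true {suc x ≡ᵇ y} h″
    ...     | inj₁ e = subst (LEdge a x) eq (up (≤-pred (subst (_< suc a) (sym eq) (<ᵇ-true⁻ {y} y<))))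
      where
      eq : suc x ≡ y
      eq = ≡ᵇ-true⁻ {suc x} {y} e
    ...     | inj₂ h‴ with ∨-true {suc y ≡ᵇ x} h‴
    ...       | inj₂ e = wrapped e
    ...       | inj₁ e = subst (λ z → LEdge a z y) eq (down (≤-pred (subst (_< suc a) (sym eq) (<ᵇ-true⁻ {x} x<))))
      where
      eq : suc y ≡ x
      eq = ≡ᵇ-true⁻ {suc y} {x} e

  LEdge⇒ladj : ∀ {a x y} → LEdge a x y → ladj a x y ≡ true
  LEdge⇒ladj {a} (up {x} x<) = ∨-trueˡ (∧-true⁺ (<ᵇ-true⁺ {x} (m<n⇒m<1+n x<)) (∧-true⁺ (<ᵇ-true⁺ {suc x} (s≤s x<))
    (∨-trueˡ (≡ᵇ-true⁺ {suc x} refl))))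
  LEdge⇒ladj {a} (down {x} x<) = ∨-trueˡ (∧-true⁺ (<ᵇ-true⁺ {suc x} (s≤s x<)) (∧-true⁺ (<ᵇ-true⁺ {x} (m<n⇒m<1+n x<))
    (∨-trueʳ (suc (suc x) ≡ᵇ x) (∨-trueˡ (≡ᵇ-true⁺ {suc x} refl)))))
  LEdge⇒ladj {a} wrap = ∨-trueˡ (∧-true⁺ (<ᵇ-true⁺ {a} (n<1+n a)) (∨-trueʳ (1 ≡ᵇ a) (∨-trueʳ ((a ≡ᵇ 0) ∧ _) (≡ᵇ-true⁺ {a} refl))))
  LEdge⇒ladj {a} unwrap = ∨-trueˡ (∧-true⁺ (<ᵇ-true⁺ {a} (n<1+n a)) (∨-trueʳ (1 ≡ᵇ a) (∨-trueˡ (≡ᵇ-true⁺ {a} refl))))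
  LEdge⇒ladj {a} pend = ∨-trueʳ ((a <ᵇ a) ∧ _) (∧-true⁺ (≡ᵇ-true⁺ {a} refl) refl)
  LEdge⇒ladj {a} unpend = ∨-trueʳ ((a <ᵇ a) ∧ _) (∨-trueˡ (∧-true⁺ (≡ᵇ-true⁺ {a} refl) refl))

LEdge-sym : ∀ {a x y} → LEdge a x y → LEdge a y x
LEdge-sym (up p)   = down p
LEdge-sym (down p) = up p
LEdge-sym wrap     = unwrap
LEdge-sym unwrap   = wrap
LEdge-sym pend     = unpend
LEdge-sym unpend   = pend

-- The index is positive because `wrap` at 0 would be a loop.
LEdge-irrefl : ∀ {a x} → LEdge (suc a) x x → ⊥
LEdge-irrefl ()

module LGraph (q : ℕ) where

  a : ℕ
  a = 2 + q

  LAdj⇒LEdge : ∀ {i j : Fin (2 + a)} → LAdj (2 + a) i j ≡ true → LEdge a (toℕ i) (toℕ j)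
  LAdj⇒LEdge {i} {j} h = ladj⇒LEdge (trans (sym (LAdj-ladj a i j)) h)

  LEdge⇒LAdj : ∀ {i j : Fin (2 + a)} → LEdge a (toℕ i) (toℕ j) → LAdj (2 + a) i j ≡ true
  LEdge⇒LAdj {i} {j} h = trans (LAdj-ladj a i j) (LEdge⇒ladj h)

  L : Graph (2 + a)
  L .adj      = LAdj (2 + a)
  L .adj-sym  i j = bool-ext (λ h → LEdge⇒LAdj (LEdge-sym (LAdj⇒LEdge {i} {j} h)))
                             (λ h → LEdge⇒LAdj (LEdge-sym (LAdj⇒LEdge {j} {i} h)))
  L .adj-irrefl i = ≢true⇒false λ h → LEdge-irrefl (LAdj⇒LEdge {i} {i} h)

  -- Below `c` a vertex walks down to 0, above `c` it walks up to `a` and wraps around. With `c` a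
  -- vertex this shows that `c` is not a cut vertex; with `c = 2 + a`, beyond all labels, it shows
  -- that `L` is connected.
  module _ (E : EdgeRel (2 + a)) (c : ℕ) (0<c : 0 < c)
    (E⊇ : ∀ i j → toℕ i ≢ c → toℕ j ≢ c → LEdge a (toℕ i) (toℕ j) → E i j ≡ true) where

    E⊇′ : ∀ i j {x y} → toℕ i ≡ x → toℕ j ≡ y → x ≢ c → y ≢ c → LEdge a x y → E i j ≡ true
    E⊇′ i j refl refl = E⊇ i j

    0≢c : 0 ≢ c
    0≢c refl = <-irrefl refl 0<c

    descend : ∀ x u → toℕ u ≡ x → x ≤ a → x < c → Reach E u zero
    descend zero    zero _ _ _ = here
    descend (suc x) u eq x<a x<c = step (E⊇′ u w eq w≡ (<⇒≢ x<c) (<⇒≢ (<-trans (n<1+n x) x<c)) (down x<a))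
                                        (descend x w w≡ (<⇒≤ x<a) (<-trans (n<1+n x) x<c))
      where
      w< : x < 2 + a
      w< = m<n⇒m<1+n (m<n⇒m<1+n x<a)
      w = fromℕ< w<
      w≡ : toℕ w ≡ x
      w≡ = toℕ-fromℕ< w<

    ascend : ∀ k u {x} → toℕ u ≡ x → x + k ≡ a → c < x → Reach E u zero
    ascend zero u {x} eq h c<x = reach-edge (E⊇′ u zero eq refl (<⇒≢ c<x ∘ sym) 0≢c (subst (λ y → LEdge a y 0) (sym (trans (sym (+-identityʳ x)) h)) wrap))
    ascend (suc k) u {x} eq h c<x = step (E⊇′ u w eq w≡ (<⇒≢ c<x ∘ sym) (<⇒≢ (m<n⇒m<1+n c<x) ∘ sym) (up x<a))
                                         (ascend k w w≡ (trans (sym (+-suc x k)) h) (m<n⇒m<1+n c<x))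
      where
      x<a : x < a
      x<a = subst (x <_) h (m<m+n x (s≤s z≤n))
      w< : suc x < 2 + a
      w< = s≤s (m<n⇒m<1+n x<a)
      w = fromℕ< w<
      w≡ : toℕ w ≡ suc x
      w≡ = toℕ-fromℕ< w<

    to-zero : ∀ u → toℕ u ≢ c → Reach E u zero
    to-zero u u≢c with toℕ u ≤? a
    ... | no u≰a = reach-edge (E⊇′ u zero (≤-antisym (≤-pred (toℕ<n u)) (≰⇒> u≰a)) refl
                      (u≢c ∘ trans (≤-antisym (≤-pred (toℕ<n u)) (≰⇒> u≰a))) 0≢c unpend)
    ... | yes u≤a with <-cmp (toℕ u) c
    ...   | tri< u<c _ _ = descend (toℕ u) u refl u≤a u<c
    ...   | tri≈ _ u≡c _ = ⊥-elim (u≢c u≡c)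
    ...   | tri> _ _ c<u = ascend (a ∸ toℕ u) u refl (m+[n∸m]≡n u≤a) c<u

  open Components L using (DeleteAdj⁺; DeleteAdj⁻; adj-swap)

  L-connected : Connected L
  L-connected u w = reach-trans (tz u) (reach-sym adj-swap (tz w))
    where
    tz : ∀ u → Reach (adj L) u zero
    tz u = to-zero (adj L) (2 + a) (s≤s z≤n) (λ i j _ _ → LEdge⇒LAdj) u (<⇒≢ (toℕ<n u))

  L-noncut : ∀ x → x ≢ zero → ∀ u w → u ≢ x → w ≢ x → Reach (DeleteAdj L x) u w
  L-noncut x x≢0 u w u≢ w≢ = reach-trans (tz u u≢) (reach-sym swap (tz w w≢))
    where
    swap : ∀ i j → DeleteAdj L x i j ≡ true → DeleteAdj L x j i ≡ true
    swap i j d = let e , p , r = DeleteAdj⁻ {x} {i} {j} d in DeleteAdj⁺ (adj-swap i j e) r p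
    tz : ∀ u → u ≢ x → Reach (DeleteAdj L x) u zero
    tz u u≢ = to-zero (DeleteAdj L x) (toℕ x) (n≢0⇒n>0 (x≢0 ∘ toℕ-injective))
      (λ i j p r e → DeleteAdj⁺ (LEdge⇒LAdj e) (p ∘ cong toℕ) (r ∘ cong toℕ)) u (u≢ ∘ toℕ-injective)

  L-cut : IsCutVertex L zero
  L-cut h with cong toℕ (reach-closed (_≡ last) stuck (h last (suc zero) (λ ()) (λ ())) refl)
    where
    last : Fin (2 + a)
    last = fromℕ (suc a)
    stuck : ∀ i j → DeleteAdj L zero i j ≡ true → i ≡ last → j ≡ last
    stuck i j d refl with DeleteAdj⁻ {zero} {i} {j} d
    ... | e , _ , j≢0 = ⊥-elim (no-edge (toℕ-fromℕ (suc a)) (j≢0 ∘ toℕ-injective) (LAdj⇒LEdge {i} {j} e))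
      where
      no-edge : ∀ {x y} → x ≡ suc a → y ≢ 0 → LEdge a x y → ⊥
      no-edge p y≢0 (up x<a) = <-asym x<a (subst (a <_) (sym p) (n<1+n a))
      no-edge p y≢0 (down x<a) = <-irrefl (suc-injective p) x<a
      no-edge p y≢0 wrap = y≢0 refl
      no-edge p y≢0 unpend = y≢0 refl
  ... | ()

  L-cycle : HasCycle L
  L-cycle = q , inject₁ , Fin.inject₁-injective
    , (λ i → LEdge⇒LAdj (subst₂ (LEdge a) (sym (trans (toℕ-inject₁ (inject₁ i)) (toℕ-inject₁ i))) (sym (toℕ-inject₁ (suc i))) (up (toℕ<n i))))
    , LEdge⇒LAdj (subst (λ x → LEdge a x 0) (sym (trans (toℕ-inject₁ (fromℕ a)) (toℕ-fromℕ a))) wrap)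

  L∈C′ : InC' 1 L
  L∈C′ = (L-connected , zero ∷ [] , [] ∷ [] , L-cut ∷ [] , only , refl) , λ t → proj₂ t L-cycle
    where
    only : ∀ x → IsCutVertex L x → x ∈ zero ∷ []
    only x cut with x ≟ zero
    ... | yes p = here p
    ... | no ¬p = ⊥-elim (cut (L-noncut x ¬p))

-- Connected subgraphs of L

module _ {P : ℕ → Set} (P? : ∀ x → Dec (P x)) where

  least : ∀ b → (∀ {w} → w < b → ¬ P w) ⊎ (∃ λ i → i < b × P i × (∀ {w} → w < i → ¬ P w))
  least zero = inj₁ λ ()
  least (suc b) with least b
  ... | inj₂ (i , i< , p , h) = inj₂ (i , m<n⇒m<1+n i< , p , h)
  ... | inj₁ h with P? b
  ...   | yes p = inj₂ (b , n<1+n b , p , h)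
  ...   | no ¬p = inj₁ λ w< → [ h , (λ { refl → ¬p }) ] (m≤n⇒m<n∨m≡n (≤-pred w<))

  greatest : ∀ b → (∀ {w} → w < b → ¬ P w) ⊎ (∃ λ j → j < b × P j × (∀ {w} → j < w → w < b → ¬ P w))
  greatest zero = inj₁ λ ()
  greatest (suc b) with P? b
  ... | yes p = inj₂ (b , n<1+n b , p , λ b<w w<1+b → ⊥-elim (<⇒≱ b<w (≤-pred w<1+b)))
  ... | no ¬p with greatest b
  ...   | inj₁ h = inj₁ λ w< → [ h , (λ { refl → ¬p }) ] (m≤n⇒m<n∨m≡n (≤-pred w<))
  ...   | inj₂ (j , j< , p , h) = inj₂ (j , m<n⇒m<1+n j< , p , λ j<w w< → [ h j<w , (λ { refl → ¬p }) ] (m≤n⇒m<n∨m≡n (≤-pred w<)))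

-- The cyclic successor on 0, ..., `a`. Naming each cycle edge by its starting vertex lets the
-- closing edge be treated like the others.
next : ℕ → ℕ → ℕ
next a k with k ℕ.≟ a
... | yes _ = 0
... | no _  = suc k

next-< : ∀ {a k} → k < a → next a k ≡ suc k
next-< {a} {k} k<a with k ℕ.≟ a
... | yes refl = ⊥-elim (<-irrefl refl k<a)
... | no _     = refl

next-last : ∀ {a} → next a a ≡ 0
next-last {a} with a ℕ.≟ a
... | yes _ = refl
... | no ¬p = ⊥-elim (¬p refl)

data Orient (a : ℕ) : ℕ → ℕ → Set where
  fwd    : ∀ {k} → k ≤ a → Orient a k (next a k)
  bwd    : ∀ {k} → k ≤ a → Orient a (next a k) k
  pend   : Orient a 0 (suc a)
  unpend : Orient a (suc a) 0

orient : ∀ {a x y} → LEdge a x y → Orient a x y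
orient (up x<a)   = subst (Orient _ _) (next-< x<a) (fwd (<⇒≤ x<a))
orient (down x<a) = subst (λ z → Orient _ z _) (next-< x<a) (bwd (<⇒≤ x<a))
orient wrap       = subst (Orient _ _) next-last (fwd ≤-refl)
orient {a} unwrap = subst (λ z → Orient a z a) (next-last {a}) (bwd ≤-refl)
orient pend       = pend
orient unpend     = unpend

-- Symmetric in the two ends, since `∈-pairs` leaves the orientation of a listed pair open.
Between : ℕ × ℕ → ℕ → Set
Between (i , j) z = (i ≤ z × z ≤ j) ⊎ (j ≤ z × z ≤ i)

between? : ∀ p z → Dec (Between p z)
between? (i , j) z = (i ≤? z ×-dec z ≤? j) ⊎-dec (j ≤? z ×-dec z ≤? i)

between-ordered : ∀ {i j z} → i ≤ j → Between (i , j) z → i ≤ z × z ≤ j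
between-ordered i≤j (inj₁ p) = p
between-ordered i≤j (inj₂ (j≤z , z≤i)) = ≤-trans i≤j j≤z , ≤-trans z≤i i≤j

between-swap : ∀ {i j z} → Between (i , j) z → Between (j , i) z
between-swap (inj₁ p) = inj₂ p
between-swap (inj₂ p) = inj₁ p

-- The shapes of connected subgraphs of L: the pendant vertex alone, an arc avoiding 0,
-- and, with or without the pendant vertex, the cycle with at most one edge deleted or
-- the complement in the cycle of an arc avoiding 0.
data Shape : Set where
  pendant : Shape
  arc     : ℕ × ℕ → Shape
  full    : Bool × Maybe ℕ → Shape
  coarc   : Bool × (ℕ × ℕ) → Shape

module Shapes (a : ℕ) where

  Vertex : Shape → ℕ → Set
  Vertex pendant         z = z ≡ suc a
  Vertex (arc p)         z = Between p z
  Vertex (full (b , _))  z = z ≤ a ⊎ (b ≡ true × z ≡ suc a)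
  Vertex (coarc (b , p)) z = (z ≤ a × ¬ Between p z) ⊎ (b ≡ true × z ≡ suc a)

  vertex? : ∀ c z → Dec (Vertex c z)
  vertex? pendant         z = z ℕ.≟ suc a
  vertex? (arc p)         z = between? p z
  vertex? (full (b , _))  z = (z ≤? a) ⊎-dec ((b Bool.≟ true) ×-dec (z ℕ.≟ suc a))
  vertex? (coarc (b , p)) z = ((z ≤? a) ×-dec ¬? (between? p z)) ⊎-dec ((b Bool.≟ true) ×-dec (z ℕ.≟ suc a))

  Gone : Shape → ℕ → ℕ → Set
  Gone (full (_ , just k)) x y = (x ≡ k × y ≡ next a k) ⊎ (y ≡ k × x ≡ next a k)
  Gone _ x y = ⊥

  gone? : ∀ c x y → Dec (Gone c x y)
  gone? (full (_ , just k)) x y = ((x ℕ.≟ k) ×-dec (y ℕ.≟ next a k)) ⊎-dec ((y ℕ.≟ k) ×-dec (x ℕ.≟ next a k))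
  gone? (full (_ , nothing)) x y = no λ ()
  gone? pendant x y = no λ ()
  gone? (arc _) x y = no λ ()
  gone? (coarc _) x y = no λ ()

  Edge : Shape → ℕ → ℕ → Set
  Edge c x y = ladj a x y ≡ true × Vertex c x × Vertex c y × ¬ Gone c x y

  edge? : ∀ c x y → Dec (Edge c x y)
  edge? c x y = (ladj a x y Bool.≟ true) ×-dec vertex? c x ×-dec vertex? c y ×-dec ¬? (gone? c x y)

  arcs : List (ℕ × ℕ)
  arcs = pairs (applyUpTo suc a)

  bools : List Bool
  bools = true ∷ false ∷ []

  shapes : List Shape
  shapes = pendant ∷ map arc arcs ++ map full (cartesianProduct bools (nothing ∷ map just (upTo (suc a))))
                   ++ map coarc (cartesianProduct bools arcs)

  length-arcs : length arcs ≡ triangle a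
  length-arcs = trans (length-pairs (applyUpTo suc a)) (cong triangle (length-applyUpTo suc a))

  -- The factor 2 is the choice of the pendant vertex; `2 + a` counts the `a + 1` cycle edges and
  -- the option of deleting none.
  length-shapes : length shapes ≡ suc (triangle a + (2 * (2 + a) + 2 * triangle a))
  length-shapes = cong suc (trans (length-++ (map arc arcs)) (cong₂ _+_ (trans (length-map arc arcs) length-arcs)
    (trans (length-++ (map full fulls)) (cong₂ _+_
      (trans (length-map full fulls) (trans (length-cartesianProduct bools (nothing ∷ map just (upTo (suc a))))
        (cong (λ k → 2 * suc k) (trans (length-map just (upTo (suc a))) (length-upTo (suc a))))))
      (trans (length-map coarc (cartesianProduct bools arcs)) (trans (length-cartesianProduct bools arcs) (cong (2 *_) length-arcs)))))))
    where
    fulls : List (Bool × Maybe ℕ)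
    fulls = cartesianProduct bools (nothing ∷ map just (upTo (suc a)))

  ∈-bools : ∀ b → b ∈ bools
  ∈-bools true  = here refl
  ∈-bools false = there (here refl)

  pendant∈ : pendant ∈ shapes
  pendant∈ = here refl

  arc∈ : ∀ {p} → p ∈ arcs → arc p ∈ shapes
  arc∈ p∈ = there (∈-++⁺ˡ (∈-map⁺ arc p∈))

  full∈ : ∀ b {k} → k ∈ nothing ∷ map just (upTo (suc a)) → full (b , k) ∈ shapes
  full∈ b k∈ = there (∈-++⁺ʳ (map arc arcs) (∈-++⁺ˡ (∈-map⁺ full (∈-cartesianProduct⁺ (∈-bools b) k∈))))

  coarc∈ : ∀ b {p} → p ∈ arcs → coarc (b , p) ∈ shapes
  coarc∈ b p∈ = there (∈-++⁺ʳ (map arc arcs) (∈-++⁺ʳ (map full _) (∈-map⁺ coarc (∈-cartesianProduct⁺ (∈-bools b) p∈))))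

  interval∈ : ∀ {i} → 1 ≤ i → i ≤ a → i ∈ applyUpTo suc a
  interval∈ {suc i} _ i<a = ∈-applyUpTo⁺ suc i<a

  ordered-arc : ∀ {i j} → 1 ≤ i → i ≤ j → j ≤ a →
                ∃ λ p → p ∈ arcs × (∀ {z} → Between p z → i ≤ z × z ≤ j) × (∀ {z} → i ≤ z → z ≤ j → Between p z)
  ordered-arc {i} {j} 1≤i i≤j j≤a with ∈-pairs (interval∈ 1≤i (≤-trans i≤j j≤a)) (interval∈ (≤-trans 1≤i i≤j) j≤a)
  ... | inj₁ p∈ = (i , j) , p∈ , between-ordered i≤j , λ x y → inj₁ (x , y)
  ... | inj₂ p∈ = (j , i) , p∈ , (between-ordered i≤j ∘ between-swap) , λ x y → inj₂ (x , y)

  -- Connectedness is stated as a closure principle because it is only ever applied to a set `Q`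
  -- closed under `e` that would separate two vertices.
  record ConnL (s : ℕ → Bool) (e : ℕ → ℕ → Bool) : Set₁ where
    field
      bounded  : ∀ {x} → s x ≡ true → x ≤ suc a
      edge     : ∀ {x y} → e x y ≡ true → LEdge a x y × s x ≡ true × s y ≡ true
      esym     : ∀ {x y} → e x y ≡ true → e y x ≡ true
      nonempty : ∃ λ x → s x ≡ true
      closed   : (Q : ℕ → Set) → (∀ {x y} → e x y ≡ true → Q x → Q y) →
                 ∀ {x y} → s x ≡ true → s y ≡ true → Q x → Q y

  record HasShape (s : ℕ → Bool) (e : ℕ → ℕ → Bool) : Set where
    field
      shape  : Shape
      shape∈ : shape ∈ shapes
      s⇒     : ∀ {z} → s z ≡ true → Vertex shape z
      s⇐     : ∀ {z} → Vertex shape z → s z ≡ true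
      e⇒     : ∀ {x y} → e x y ≡ true → ¬ Gone shape x y
      e⇐     : ∀ {x y} → LEdge a x y → s x ≡ true → s y ≡ true → ¬ Gone shape x y → e x y ≡ true

  module Classify {s : ℕ → Bool} {e : ℕ → ℕ → Bool} (C : ConnL s e) where
    open ConnL C

    above⇒suc : ∀ {i j} → j < i → ∃ λ k → i ≡ suc k
    above⇒suc (s≤s {n = k} _) = k , refl

    module ZeroOut (s0 : s 0 ≡ false) where

      -- Without 0 only the edges of a path remain, and a path falls apart at each missing edge.
      cut : ∀ x → ¬ (e x (suc x) ≡ true) → ∀ {u w} → s u ≡ true → s w ≡ true → u ≤ x → x < w → ⊥
      cut x miss su sw u≤x x<w = <⇒≱ x<w (closed (_≤ x) stay su sw u≤x)
        where
        stay : ∀ {u w} → e u w ≡ true → u ≤ x → w ≤ x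
        stay h u≤x with edge h
        ... | up _ , _ , _ with m≤n⇒m<n∨m≡n u≤x
        ...   | inj₁ u<x  = u<x
        ...   | inj₂ refl = ⊥-elim (miss h)
        stay h u≤x | down _ , _ , _ = <⇒≤ u≤x
        stay h u≤x | wrap , _ , s0′ = ⊥-elim (true≢false s0′ s0)
        stay h u≤x | unwrap , s0′ , _ = ⊥-elim (true≢false s0′ s0)
        stay h u≤x | pend , s0′ , _ = ⊥-elim (true≢false s0′ s0)
        stay h u≤x | unpend , _ , s0′ = ⊥-elim (true≢false s0′ s0)

      pendant-shape : s (suc a) ≡ true → HasShape s e
      pendant-shape sp = record
        { shape = pendant ; shape∈ = pendant∈
        ; s⇒ = λ sz → all sz
        ; s⇐ = λ { refl → sp }
        ; e⇒ = λ _ ()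
        ; e⇐ = λ l sx sy _ → ⊥-elim (lone (all sx) (all sy) l) }
        where
        stay : ∀ {u w} → e u w ≡ true → u ≡ suc a → w ≡ suc a
        stay h eq with edge h
        ... | up u<a , _ , _ = ⊥-elim (<⇒≱ u<a (subst (a ≤_) (sym eq) (n≤1+n a)))
        ... | down w<a , _ , _ = ⊥-elim (<-irrefl (suc-injective eq) w<a)
        ... | wrap , _ , s0′ = ⊥-elim (true≢false s0′ s0)
        ... | unwrap , s0′ , _ = ⊥-elim (true≢false s0′ s0)
        ... | pend , s0′ , _ = ⊥-elim (true≢false s0′ s0)
        ... | unpend , _ , s0′ = ⊥-elim (true≢false s0′ s0)
        all : ∀ {z} → s z ≡ true → z ≡ suc a
        all sz = closed (_≡ suc a) stay sp sz refl
        lone : ∀ {x y} → x ≡ suc a → y ≡ suc a → LEdge a x y → ⊥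
        lone p r (up _) = 1+n≢n (trans r (sym p))
        lone p r (down _) = 1+n≢n (trans p (sym r))

      ≤a : s (suc a) ≡ false → ∀ {z} → s z ≡ true → z ≤ a
      ≤a sp sz = ≤-pred (≤∧≢⇒< (bounded sz) λ { refl → true≢false sz sp })

      -- Between the least and the greatest vertex nothing can be missing, vertex or edge, as either
      -- would separate these two.
      arc-shape : s (suc a) ≡ false → HasShape s e
      arc-shape sp with least (λ x → s x Bool.≟ true) (suc a) | greatest (λ x → s x Bool.≟ true) (suc a)
      ... | inj₁ none | _ = ⊥-elim (none (s≤s (≤a sp (proj₂ nonempty))) (proj₂ nonempty))
      ... | inj₂ _ | inj₁ none = ⊥-elim (none (s≤s (≤a sp (proj₂ nonempty))) (proj₂ nonempty))
      ... | inj₂ (i , i< , si , below) | inj₂ (j , j< , sj , above) = build (ordered-arc 1≤i i≤j (≤-pred j<))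
        where
        1≤i : 1 ≤ i
        1≤i = n≢0⇒n>0 λ { refl → true≢false si s0 }
        i≤j : i ≤ j
        i≤j = ≮⇒≥ λ j<i → below j<i sj
        fill : ∀ {z} → i ≤ z → z ≤ j → s z ≡ true
        fill {z} i≤z z≤j with s z Bool.≟ true
        ... | yes sz = sz
        ... | no ¬sz with above⇒suc (≤∧≢⇒< i≤z λ { refl → ¬sz si })
        -- An absent vertex `suc k` forces the edge from `k` to `suc k` to be absent.
        ...   | k , refl = ⊥-elim (cut k (λ h → ¬sz (proj₂ (proj₂ (edge h)))) si sj (≤-pred (≤∧≢⇒< i≤z λ { refl → ¬sz si })) z≤j)
        edges : ∀ {x y} → LEdge a x y → s x ≡ true → s y ≡ true → e x y ≡ true
        edges (up {x} _) sx sy = decidable-stable (_ Bool.≟ _) λ miss → cut x miss sx sy ≤-refl (n<1+n x)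
        edges (down {x} _) sx sy = esym (decidable-stable (_ Bool.≟ _) λ miss → cut x miss sy sx ≤-refl (n<1+n x))
        edges wrap _ s0′ = ⊥-elim (true≢false s0′ s0)
        edges unwrap s0′ _ = ⊥-elim (true≢false s0′ s0)
        edges pend s0′ _ = ⊥-elim (true≢false s0′ s0)
        edges unpend _ s0′ = ⊥-elim (true≢false s0′ s0)
        build : (∃ λ p → p ∈ arcs × (∀ {z} → Between p z → i ≤ z × z ≤ j) × (∀ {z} → i ≤ z → z ≤ j → Between p z)) → HasShape s e
        build (p , p∈ , out , into) = record
          { shape = arc p ; shape∈ = arc∈ p∈
          ; s⇒ = λ sz → into (≮⇒≥ λ z<i → below z<i sz) (≮⇒≥ λ j<z → above j<z (s≤s (≤a sp sz)) sz)
          ; s⇐ = λ b → uncurry fill (out b)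
          ; e⇒ = λ _ ()
          ; e⇐ = λ l sx sy _ → edges l sx sy }

    module ZeroIn (s0 : s 0 ≡ true) where

      Miss : ℕ → Set
      Miss k = ¬ (e k (next a k) ≡ true)

      -- Two missing cycle edges separate the arc between them from 0.
      cut : ∀ x y → Miss x → Miss y → y ≤ a → ∀ {u} → s u ≡ true → x < u → u ≤ y → ⊥
      cut x y mx my y≤a su x<u u≤y with closed (λ z → x < z × z ≤ y) stay su s0 (x<u , u≤y)
        where
        stay : ∀ {u w} → e u w ≡ true → x < u × u ≤ y → x < w × w ≤ y
        stay h (x<u , u≤y) with edge h
        ... | down _ , _ , _ with m≤n⇒m<n∨m≡n (≤-pred x<u)
        ...   | inj₁ x<w = x<w , <⇒≤ u≤y
        ...   | inj₂ refl = ⊥-elim (mx (subst (λ z → e x z ≡ true) (sym (next-< (<-≤-trans (n<1+n x) (≤-trans u≤y y≤a)))) (esym h)))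
        stay h (x<u , u≤y) | up u<a , _ , _ with m≤n⇒m<n∨m≡n u≤y
        ...   | inj₁ u<y = m<n⇒m<1+n x<u , u<y
        ...   | inj₂ refl = ⊥-elim (my (subst (λ z → e y z ≡ true) (sym (next-< u<a)) h))
        stay h (x<u , u≤y) | wrap , _ , _ with ≤-antisym u≤y y≤a
        ...   | refl = ⊥-elim (my (subst (λ z → e y z ≡ true) (sym next-last) h))
        stay h (() , u≤y) | unwrap , _ , _
        stay h (() , u≤y) | pend , _ , _
        stay h (x<u , u≤y) | unpend , _ , _ = ⊥-elim (<⇒≱ u≤y y≤a)
      ... | () , _

      pend-edge : s (suc a) ≡ true → e 0 (suc a) ≡ true
      pend-edge sp = decidable-stable (_ Bool.≟ _) λ miss → 0≢1+n (closed (_≡ suc a) (stay miss) sp s0 refl)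
        where
        stay : ¬ (e 0 (suc a) ≡ true) → ∀ {u w} → e u w ≡ true → u ≡ suc a → w ≡ suc a
        stay miss h eq with edge h
        ... | up u<a , _ , _ = ⊥-elim (<⇒≱ u<a (subst (a ≤_) (sym eq) (n≤1+n a)))
        ... | down w<a , _ , _ = ⊥-elim (<-irrefl (suc-injective eq) w<a)
        ... | wrap , _ , _ = ⊥-elim (1+n≢n (sym eq))
        ... | unpend , _ , _ = ⊥-elim (miss (esym h))

      -- The pendant edge is settled by `pend-edge` and reversals by `esym`, so only cycle edges in
      -- forward direction remain to be checked.
      from-cycle : ∀ {c} → (∀ {k} → k ≤ a → s k ≡ true → s (next a k) ≡ true →
                     ¬ Gone c k (next a k) → ¬ Gone c (next a k) k → e k (next a k) ≡ true) →
                   (∀ {x y} → Gone c x y → Gone c y x) →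
                   ∀ {x y} → LEdge a x y → s x ≡ true → s y ≡ true → ¬ Gone c x y → e x y ≡ true
      from-cycle cyc flip l sx sy ¬g with orient l
      ... | fwd k≤a = cyc k≤a sx sy ¬g (¬g ∘ flip)
      ... | bwd k≤a = esym (cyc k≤a sy sx (¬g ∘ flip) ¬g)
      ... | pend    = pend-edge sy
      ... | unpend  = esym (pend-edge sx)

      top : ∀ {z} → s z ≡ true → ¬ (z ≤ a) → s (suc a) ≡ true × z ≡ suc a
      top sz z≰a with ≤-antisym (bounded sz) (≰⇒> z≰a)
      ... | refl = sz , refl

      -- The first and last absent cycle vertices `i` and `j` come with missing edges, so a vertex
      -- between them would be cut off from 0. A missing edge between present vertices outside would
      -- likewise cut off the stretch between it and the gap.
      coarc-shape : ∀ {i j} → i ≤ a → s i ≡ false → (∀ {w} → w < i → s w ≡ true) →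
                    j ≤ a → s j ≡ false → (∀ {w} → j < w → w ≤ a → s w ≡ true) → HasShape s e
      coarc-shape {i} {j} i≤a si below j≤a sj above = build (ordered-arc 1≤i i≤j j≤a)
        where
        1≤i : 1 ≤ i
        1≤i = n≢0⇒n>0 λ { refl → true≢false s0 si }
        i≤j : i ≤ j
        i≤j = ≮⇒≥ λ j<i → true≢false (below j<i) sj
        missˡ : ∀ {k} → s k ≡ false → Miss k
        missˡ sk h = true≢false (proj₁ (proj₂ (edge h))) sk
        missʳ : ∀ {k} → suc k ≤ a → s (suc k) ≡ false → Miss k
        missʳ k<a sk h = true≢false (subst (λ z → s z ≡ true) (next-< k<a) (proj₂ (proj₂ (edge h)))) sk
        outside : ∀ {z} → s z ≡ true → i ≤ z → z ≤ j → ⊥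
        outside {z} sz i≤z z≤j with above⇒suc (≤∧≢⇒< z≤j λ { refl → true≢false sz sj })
        ... | k , refl = cut i k (missˡ si) (missʳ j≤a sj) (<⇒≤ j≤a) sz
                           (≤∧≢⇒< i≤z λ { refl → true≢false sz si }) (≤-pred (≤∧≢⇒< z≤j λ { refl → true≢false sz sj }))
        cyc : ∀ {k} → k ≤ a → s k ≡ true → s (next a k) ≡ true → Miss k → ⊥
        cyc {k} k≤a sk sn miss with <-cmp k i
        ... | tri≈ _ refl _ = true≢false sk si
        ... | tri> _ _ i<k = cut j k (missˡ sj) miss k≤a sk (≰⇒> (outside sk (<⇒≤ i<k))) ≤-refl
        ... | tri< k<i _ _ with above⇒suc k<i
        ...   | i′ , refl = cut k i′ miss (missʳ i≤a si) (<⇒≤ i≤a) sk′ (n<1+n k)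
                              (≤-pred (≤∧≢⇒< k<i λ eq → true≢false sk′ (subst (λ z → s z ≡ false) (sym eq) si)))
          where
          sk′ : s (suc k) ≡ true
          sk′ = subst (λ z → s z ≡ true) (next-< (<-≤-trans k<i i≤a)) sn
        build : (∃ λ p → p ∈ arcs × (∀ {z} → Between p z → i ≤ z × z ≤ j) × (∀ {z} → i ≤ z → z ≤ j → Between p z)) → HasShape s e
        build (p , p∈ , out , into) = record
          { shape = coarc (s (suc a) , p) ; shape∈ = coarc∈ (s (suc a)) p∈
          ; s⇒ = λ {z} sz → classify sz (z ≤? a)
          ; s⇐ = λ { (inj₁ (z≤a , ¬b)) → inside z≤a ¬b ; (inj₂ (sp , refl)) → sp }
          ; e⇒ = λ _ ()
          ; e⇐ = from-cycle {coarc (s (suc a) , p)} (λ k≤a sk sn _ _ → decidable-stable (_ Bool.≟ _) (cyc k≤a sk sn)) (λ ()) }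
          where
          classify : ∀ {z} → s z ≡ true → Dec (z ≤ a) → Vertex (coarc (s (suc a) , p)) z
          classify sz (yes z≤a) = inj₁ (z≤a , λ b → uncurry (outside sz) (out b))
          classify sz (no z≰a) = inj₂ (top sz z≰a)
          inside : ∀ {z} → z ≤ a → ¬ Between p z → s z ≡ true
          inside {z} z≤a ¬b with z <? i | j <? z
          ... | yes z<i | _ = below z<i
          ... | no _ | yes j<z = above j<z z≤a
          ... | no z≮i | no j≮z = ⊥-elim (¬b (into (≮⇒≥ z≮i) (≮⇒≥ j≮z)))

      -- Once one cycle edge is missing, a second one would cut off the vertices between the two.
      full-shape : (∀ {z} → z ≤ a → s z ≡ true) → HasShape s e
      full-shape all with least (λ k → ¬? (e k (next a k) Bool.≟ true)) (suc a)
      ... | inj₁ none = record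
        { shape = full (s (suc a) , nothing) ; shape∈ = full∈ (s (suc a)) (here refl)
        ; s⇒ = λ {z} sz → classify sz (z ≤? a)
        ; s⇐ = λ { (inj₁ z≤a) → all z≤a ; (inj₂ (sp , refl)) → sp }
        ; e⇒ = λ _ ()
        ; e⇐ = from-cycle {full (s (suc a) , nothing)} (λ k≤a _ _ _ _ → decidable-stable (_ Bool.≟ _) (none (s≤s k≤a))) (λ ()) }
        where
        classify : ∀ {z} → s z ≡ true → Dec (z ≤ a) → Vertex (full (s (suc a) , nothing)) z
        classify sz (yes z≤a) = inj₁ z≤a
        classify sz (no z≰a) = inj₂ (top sz z≰a)
      ... | inj₂ (k , k< , miss , _) = record
        { shape = full (s (suc a) , just k) ; shape∈ = full∈ (s (suc a)) (there (∈-map⁺ just (∈-upTo⁺ k<)))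
        ; s⇒ = λ {z} sz → classify sz (z ≤? a)
        ; s⇐ = λ { (inj₁ z≤a) → all z≤a ; (inj₂ (sp , refl)) → sp }
        ; e⇒ = λ { h (inj₁ (refl , refl)) → miss h ; h (inj₂ (refl , refl)) → miss (esym h) }
        ; e⇐ = from-cycle {full (s (suc a) , just k)} cyc
                 (λ { (inj₁ (p , r)) → inj₂ (p , r) ; (inj₂ (p , r)) → inj₁ (p , r) }) }
        where
        classify : ∀ {z} → s z ≡ true → Dec (z ≤ a) → Vertex (full (s (suc a) , just k)) z
        classify sz (yes z≤a) = inj₁ z≤a
        classify sz (no z≰a) = inj₂ (top sz z≰a)
        cyc : ∀ {l} → l ≤ a → s l ≡ true → s (next a l) ≡ true →
              ¬ Gone (full (s (suc a) , just k)) l (next a l) → ¬ Gone (full (s (suc a) , just k)) (next a l) l → e l (next a l) ≡ true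
        cyc {l} l≤a sl _ ¬g _ = decidable-stable (_ Bool.≟ _) λ miss′ → by miss′ (<-cmp k l)
          where
          by : Miss l → _ → ⊥
          by miss′ (tri< k<l _ _) = cut k l miss miss′ l≤a sl k<l ≤-refl
          by miss′ (tri≈ _ refl _) = ¬g (inj₁ (refl , refl))
          by miss′ (tri> _ _ l<k) = cut l k miss′ miss (≤-pred k<) (all (≤-pred k<)) l<k ≤-refl

      in-shape : HasShape s e
      in-shape with least (λ x → s x Bool.≟ false) (suc a) | greatest (λ x → s x Bool.≟ false) (suc a)
      ... | inj₁ none | _ = full-shape λ z≤a → Bool.¬-not (none (s≤s z≤a))
      ... | inj₂ _ | inj₁ none = full-shape λ z≤a → Bool.¬-not (none (s≤s z≤a))
      ... | inj₂ (i , i< , si , below) | inj₂ (j , j< , sj , above) =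
        coarc-shape (≤-pred i<) si (λ w< → Bool.¬-not (below w<)) (≤-pred j<) sj (λ j<w w≤a → Bool.¬-not (above j<w (s≤s w≤a)))

    has-shape : HasShape s e
    has-shape with s 0 in s0 | s (suc a) in sp
    ... | true | _ = ZeroIn.in-shape s0
    ... | false | true = ZeroOut.pendant-shape s0 sp
    ... | false | false = ZeroOut.arc-shape s0 sp

-- Upper bound for L, by passing to natural number labels

extend : (Fin n → Bool) → ℕ → Bool
extend {zero}  f _       = false
extend {suc n} f zero    = f zero
extend {suc n} f (suc x) = extend (f ∘ suc) x

extend-toℕ : (f : Fin n → Bool) (i : Fin n) → extend f (toℕ i) ≡ f i
extend-toℕ f zero    = refl
extend-toℕ f (suc i) = extend-toℕ (f ∘ suc) i

extend-true : (f : Fin n → Bool) (x : ℕ) → extend f x ≡ true → ∃ λ i → toℕ i ≡ x × f i ≡ true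
extend-true {suc n} f zero    h = zero , refl , h
extend-true {suc n} f (suc x) h = let i , p , q = extend-true (f ∘ suc) x h in suc i , cong suc p , q

module UpperBound (q : ℕ) where
  open LGraph q
  open Shapes a

  realise : Shape → SubG (2 + a)
  realise c = subgraph (λ i → does (vertex? c (toℕ i))) (λ i j → does (edge? c (toℕ i) (toℕ j)))

  module _ (H : SubG (2 + a)) (H-conn : IsConnSubgraph L H) where

    s′ : Fin (2 + a) → Bool
    s′ = lookup (proj₁ H)

    e′ : EdgeRel (2 + a)
    e′ i j = lookup (lookup (proj₂ H) i) j

    s : ℕ → Bool
    s = extend s′

    e : ℕ → ℕ → Bool
    e x y = extend (λ i → extend (e′ i) y) x

    e-toℕ : ∀ i j → e (toℕ i) (toℕ j) ≡ e′ i j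
    e-toℕ i j = trans (extend-toℕ (λ i → extend (e′ i) (toℕ j)) i) (extend-toℕ (e′ i) j)

    s-toℕ : ∀ i → s (toℕ i) ≡ s′ i
    s-toℕ = extend-toℕ s′

    e-true : ∀ {x y} → e x y ≡ true → ∃₂ λ i j → toℕ i ≡ x × toℕ j ≡ y × e′ i j ≡ true
    e-true {x} {y} h with extend-true (λ i → extend (e′ i) y) x h
    ... | i , p , h′ with extend-true (e′ i) y h′
    ...   | j , r , h″ = i , j , p , r , h″

    connL : ConnL s e
    connL .ConnL.bounded {x} h with extend-true s′ x h
    ... | i , refl , _ = ≤-pred (toℕ<n i)
    connL .ConnL.edge {x} {y} h with e-true {x} {y} h
    ... | i , j , refl , refl , h′ with proj₁ H-conn i j h′
    ...   | l , p , r = LAdj⇒LEdge {i} {j} l , trans (s-toℕ i) p , trans (s-toℕ j) r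
    connL .ConnL.esym {x} {y} h with e-true {x} {y} h
    ... | i , j , refl , refl , h′ = trans (e-toℕ j i) (trans (sym (proj₁ (proj₂ H-conn) i j)) h′)
    connL .ConnL.nonempty = let i , h = proj₁ (proj₂ (proj₂ H-conn)) in toℕ i , trans (s-toℕ i) h
    connL .ConnL.closed Q stay {x} {y} hx hy with extend-true s′ x hx | extend-true s′ y hy
    ... | i , refl , hi | j , refl , hj =
      reach-closed (Q ∘ toℕ) (λ k l h → stay (trans (e-toℕ k l) h)) (proj₂ (proj₂ (proj₂ H-conn)) i j hi hj)

    open HasShape (Classify.has-shape connL)

    realised : H ∈ map realise shapes
    realised = subst (_∈ map realise shapes) (sym (subgraph-complete H same-s same-e)) (∈-map⁺ realise shape∈)
      where
      same-s : ∀ i → s′ i ≡ does (vertex? shape (toℕ i))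
      same-s i = bool-ext (λ h → dec-true (vertex? shape (toℕ i)) (s⇒ (trans (s-toℕ i) h)))
                          (λ h → trans (sym (s-toℕ i)) (s⇐ (does-true (vertex? shape (toℕ i)) h)))
      same-e : ∀ i j → e′ i j ≡ does (edge? shape (toℕ i) (toℕ j))
      same-e i j = bool-ext
        (λ h → let h′ = trans (e-toℕ i j) h ; l , p , r = ConnL.edge connL h′ in
          dec-true (edge? shape (toℕ i) (toℕ j)) (LEdge⇒ladj l , s⇒ p , s⇒ r , e⇒ h′))
        (λ h → let l , p , r , ¬g = does-true (edge? shape (toℕ i) (toℕ j)) h in
          trans (sym (e-toℕ i j)) (e⇐ (ladj⇒LEdge l) (s⇐ p) (s⇐ r) ¬g))

  F-L : ∃ λ k → F L k × k ≤ suc (triangle a + (2 * (2 + a) + 2 * triangle a))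
  F-L = let k , c , k≤ = count-cover (isConnSubgraph? L) _≟SubG_ (map realise shapes) realised in
    k , c , subst (k ≤_) (trans (length-map realise shapes) length-shapes) k≤

-- A 2-regular block with a single further vertex is L

module CycleIso {a : ℕ} (G : Graph (2 + a)) (conn : Connected G) (v : Fin (2 + a))
  (noncut : ∀ x → x ≢ v → ∀ u w → u ≢ x → w ≢ x → Reach (DeleteAdj G x) u w)
  (x₀ y₀ : Fin (2 + a)) (x₀≢v : x₀ ≢ v) (y₀≢v : y₀ ≢ v) (x₀y₀ : adj G x₀ y₀ ≡ true) where

  open Block G conn v noncut x₀ y₀ x₀≢v y₀≢v x₀y₀

  module _ (degree≤2 : ∀ {u} → u ∈ lB → length (nbrs u) ≤ 2) (p : Fin (2 + a)) (p∈R : p ∈ lR) (R≡p : ∀ {z} → z ∈ lR → z ≡ p)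
    (|A|≡a : length lA ≡ a) where

    two-neighbours : ∀ {u x y w} → inB u ≡ true → Nbr u x → Nbr u y → x ≢ y → Nbr u w → w ≡ x ⊎ w ≡ y
    two-neighbours {u} {x} {y} {w} hu nx ny x≢y nw with w ≟ x | w ≟ y
    ... | yes p | _ = inj₁ p
    ... | no _ | yes p = inj₂ p
    ... | no w≢x | no w≢y = ⊥-elim (<⇒≱ (length-⊆ {xs = w ∷ x ∷ y ∷ []} ((w≢x ∷ w≢y ∷ []) ∷ ((x≢y ∷ []) ∷ ([] ∷ [])))
      λ { (here refl) → ∈-nbrs⁺ nw ; (there (here refl)) → ∈-nbrs⁺ nx ; (there (there (here refl))) → ∈-nbrs⁺ ny })
      (degree≤2 (inB⇒∈ hu)))

    record Dart : Set where
      field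
        cur nxt : Fin (2 + a)
        cur∈    : inB cur ≡ true
        nxt∈    : inB nxt ≡ true
        joined  : adj G cur nxt ≡ true
    open Dart

    turn : (d : Dart) → ∃ λ w → w ≢ cur d × inB w ≡ true × adj G (nxt d) w ≡ true
    turn d = second-neighbour (nxt∈ d) (cur∈ d) (adj-swap _ _ (joined d))

    advance : Dart → Dart
    advance d .cur    = nxt d
    advance d .nxt    = proj₁ (turn d)
    advance d .cur∈   = nxt∈ d
    advance d .nxt∈   = proj₁ (proj₂ (proj₂ (turn d)))
    advance d .joined = proj₂ (proj₂ (proj₂ (turn d)))

    -- A walk from `v` that never turns straight back; in a 2-regular block it has to run around a
    -- cycle.
    dart : ℕ → Dart
    dart zero .cur    = v
    dart zero .nxt    = proj₁ (neighbour with-v-v)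
    dart zero .cur∈   = with-v-v
    dart zero .nxt∈   = proj₁ (proj₂ (neighbour with-v-v))
    dart zero .joined = proj₂ (proj₂ (neighbour with-v-v))
    dart (suc i)      = advance (dart i)

    abstract
      c : ℕ → Fin (2 + a)
      c i = cur (dart i)

      c0 : c 0 ≡ v
      c0 = refl

      c∈ : ∀ i → inB (c i) ≡ true
      c∈ i = cur∈ (dart i)

      c-adj : ∀ i → adj G (c i) (c (suc i)) ≡ true
      c-adj i = joined (dart i)

      c-turn : ∀ i → c (suc (suc i)) ≢ c i
      c-turn i = proj₁ (proj₂ (turn (dart i)))

    c-next : ∀ i → Nbr (c i) (c (suc i))
    c-next i = c∈ (suc i) , c-adj i

    c-prev : ∀ i → Nbr (c (suc i)) (c i)
    c-prev i = c∈ i , adj-swap _ _ (c-adj i)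

    InjectiveBelow : ℕ → Set
    InjectiveBelow t = ∀ {i j} → i < t → j < t → c i ≡ c j → i ≡ j

    -- The walk cannot return to an inner vertex, which has both its neighbours on the walk already.
    return : ∀ {t i} → InjectiveBelow (suc t) → i < t → c (suc i) ≡ c (suc t) → ⊥
    return {t} {i} inj i<t eq with m≤n⇒m<n∨m≡n i<t
    ... | inj₂ refl = adj⇒≢ (c-adj (suc i)) eq
    ... | inj₁ 1+i<t with two-neighbours (c∈ (suc i)) (c-prev i) (c-next (suc i)) (c-turn i ∘ sym)
                         (subst (λ z → Nbr z (c t)) (sym eq) (c-prev t))
    ...   | inj₁ h = <⇒≢ i<t (sym (inj (n<1+n t) (m<n⇒m<1+n i<t) h))
    ...   | inj₂ h with inj (n<1+n t) (s≤s 1+i<t) h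
    ...     | refl = c-turn (suc i) (sym eq)

    -- An injective stretch has at most `2 + a` vertices, so a repetition occurs within the fuel,
    -- and by `return` the first one is at the starting vertex.
    close : ∀ fuel t → 1 ≤ t → InjectiveBelow (suc t) → 2 + a < fuel + suc t →
            ∃ λ t → InjectiveBelow (suc t) × c (suc t) ≡ c 0
    close zero t _ inj h = contradiction
      (injective⇒≤ {f = λ (i : Fin (suc t)) → c (toℕ i)} (λ {i} {j} e → toℕ-injective (inj (toℕ<n i) (toℕ<n j) e))) (<⇒≱ h)
    close (suc k) t 1≤t inj h with least (λ i → c i ≟ c (suc t)) (suc t)
    ... | inj₂ (zero , _ , e , _) = t , inj , sym e
    ... | inj₂ (suc i , i< , e , _) = ⊥-elim (return inj (≤-pred i<) e)
    ... | inj₁ fresh = close k (suc t) (s≤s z≤n) inj′ (subst (2 + a <_) (sym (+-suc k (suc t))) h)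
      where
      inj′ : InjectiveBelow (suc (suc t))
      inj′ i< j< e with m≤n⇒m<n∨m≡n (≤-pred i<) | m≤n⇒m<n∨m≡n (≤-pred j<)
      ... | inj₁ i<t | inj₁ j<t = inj i<t j<t e
      ... | inj₂ refl | inj₂ refl = refl
      ... | inj₁ i<t | inj₂ refl = ⊥-elim (fresh i<t e)
      ... | inj₂ refl | inj₁ j<t = ⊥-elim (fresh j<t (sym e))

    closed-walk : ∃ λ t → InjectiveBelow (suc t) × c (suc t) ≡ c 0
    closed-walk = close (2 + a) 1 ≤-refl start (m<m+n (2 + a) (s≤s z≤n))
      where
      start : InjectiveBelow 2
      start {zero} {zero} _ _ _ = refl
      start {zero} {suc zero} _ _ e = ⊥-elim (adj⇒≢ (c-adj 0) e)
      start {suc zero} {zero} _ _ e = ⊥-elim (adj⇒≢ (c-adj 0) (sym e))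
      start {suc zero} {suc zero} _ _ _ = refl
      start {suc (suc _)} (s≤s (s≤s ())) _ _
      start {zero} {suc (suc _)} _ (s≤s (s≤s ())) _
      start {suc zero} {suc (suc _)} _ (s≤s (s≤s ())) _

    module _ {t : ℕ} (inj : InjectiveBelow (suc t)) (back : c (suc t) ≡ c 0) where

      last-prev : Nbr (c 0) (c t)
      last-prev = subst (λ z → Nbr z (c t)) back (c-prev t)

      1≢t : 1 ≢ t
      1≢t refl = c-turn 0 back

      c1≢ct : c 1 ≢ c t
      c1≢ct e = 1≢t (inj (s≤s (n≢0⇒n>0 t≢0)) (n<1+n t) e)
        where
        t≢0 : t ≢ 0
        t≢0 refl = adj⇒≢ (c-adj 0) (sym back)

      next-on-walk : ∀ {i} → i ≤ t → ∃ λ j → j ≤ t × c j ≡ c (suc i) × LEdge t i j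
      next-on-walk {i} i≤t with m≤n⇒m<n∨m≡n i≤t
      ... | inj₁ i<t = suc i , i<t , refl , up i<t
      ... | inj₂ refl = 0 , z≤n , sym back , wrap

      walk-neighbour : ∀ {i w} → i ≤ t → Nbr (c i) w → ∃ λ j → j ≤ t × c j ≡ w × LEdge t i j
      walk-neighbour {zero} i≤t nw with two-neighbours (c∈ 0) (c-next 0) last-prev c1≢ct nw
      ... | inj₁ refl = next-on-walk i≤t
      ... | inj₂ refl = t , ≤-refl , refl , unwrap
      walk-neighbour {suc i} i≤t nw with two-neighbours (c∈ (suc i)) (c-next (suc i)) (c-prev i) (c-turn i) nw
      ... | inj₁ refl = next-on-walk i≤t
      ... | inj₂ refl = i , <⇒≤ i≤t , refl , down i≤t

      -- The vertices of the closed walk have no block neighbours off the walk, and the block is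
      -- connected.
      walk-covers : ∀ {z} → inB z ≡ true → ∃ λ i → i ≤ t × c i ≡ z
      walk-covers {z} hz with with-v⁻ hz
      ... | inj₁ refl = 0 , z≤n , c0
      ... | inj₂ Az = reach-closed (λ z → ∃ λ i → i ≤ t × c i ≡ z) stay (side-connected sideA Az) (0 , z≤n , c0)
        where
        stay : ∀ x y → induced inB x y ≡ true → (∃ λ i → i ≤ t × c i ≡ x) → ∃ λ i → i ≤ t × c i ≡ y
        stay x y h (i , i≤t , refl) = let e , _ , hy = induced⁻ h ; j , j≤t , q , _ = walk-neighbour i≤t (hy , e) in j , j≤t , q

      t≡a : t ≡ a
      t≡a = trans (suc-injective (trans (sym (length-applyUpTo c (suc t))) (≤-antisym
        (length-⊆ (Unique.applyUpTo⁺₁ c (suc t) λ i<j j< e → <⇒≢ i<j (inj (<-trans i<j j<) j< e)) to-B)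
        (length-⊆ lB! λ z∈ → from-B (walk-covers (∈⇒inB z∈)))))) |A|≡a
        where
        to-B : ∀ {z} → z ∈ applyUpTo c (suc t) → z ∈ lB
        to-B z∈ with ∈-applyUpTo⁻ c z∈
        ... | i , _ , refl = inB⇒∈ (c∈ i)
        from-B : ∀ {z} → (∃ λ i → i ≤ t × c i ≡ z) → z ∈ applyUpTo c (suc t)
        from-B (i , i≤t , refl) = ∈-applyUpTo⁺ c (s≤s i≤t)

    module _ (inj : InjectiveBelow (suc a)) (back : c (suc a) ≡ c 0) where

      p≢v : p ≢ v
      p≢v = proj₁ (∈R⁻ p∈R)

      p∉B : inB p ≡ true → ⊥
      p∉B h with with-v⁻ h
      ... | inj₁ p≡v = p≢v p≡v
      ... | inj₂ Ap  = proj₂ (∈R⁻ p∈R) (member⁻ Ap)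

      p-neighbour : ∀ {w} → adj G p w ≡ true → w ≡ v
      p-neighbour {w} e with exits sideR e (member⁺ p∈R)
      ... | inj₂ w≡v = w≡v
      ... | inj₁ Rw  = ⊥-elim (adj⇒≢ e (sym (R≡p (member⁻ Rw))))

      pv : adj G p v ≡ true
      pv with reach-first (conn p v) p≢v
      ... | w , e = subst (λ z → adj G p z ≡ true) (p-neighbour e) e

      -- The isomorphism as a relation between vertices and labels. It is injective in both
      -- directions, so the independent choices made in `at` and `place` are inverse to each other.
      data At : Fin (2 + a) → ℕ → Set where
        cyc : ∀ {k} → k ≤ a → At (c k) k
        pen : At p (suc a)

      at : ∀ z → ∃ λ k → k < 2 + a × At z k
      at z with cases z
      ... | inj₁ refl with walk-covers inj back (with-v-v {inA})
      ...   | i , i≤a , e = i , s≤s (m≤n⇒m≤1+n i≤a) , subst (λ z → At z i) e (cyc i≤a)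
      at z | inj₂ (inj₁ z∈) with walk-covers inj back (with-v⁺ (member⁺ z∈))
      ...   | i , i≤a , refl = i , s≤s (m≤n⇒m≤1+n i≤a) , cyc i≤a
      at z | inj₂ (inj₂ z∈) = suc a , n<1+n (suc a) , subst (λ z → At z (suc a)) (sym (R≡p z∈)) pen

      at-injective : ∀ {z w k l} → At z k → At w l → z ≡ w → k ≡ l
      at-injective (cyc k≤) (cyc l≤) e = inj (s≤s k≤) (s≤s l≤) e
      at-injective (cyc {k} _) pen e = ⊥-elim (p∉B (subst (λ z → inB z ≡ true) e (c∈ k)))
      at-injective pen (cyc {k} _) e = ⊥-elim (p∉B (subst (λ z → inB z ≡ true) (sym e) (c∈ k)))
      at-injective pen pen _ = refl

      at-functional : ∀ {z w k} → At z k → At w k → z ≡ w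
      at-functional (cyc _) (cyc _) = refl
      at-functional (cyc k≤) pen    = ⊥-elim (<-irrefl refl k≤)
      at-functional pen (cyc k≤)    = ⊥-elim (<-irrefl refl k≤)
      at-functional pen pen         = refl

      v-at : ∀ {l} → At v l → l ≡ 0
      v-at h = at-injective h (cyc z≤n) (sym c0)

      adj⇒LEdge : ∀ {z w k l} → At z k → At w l → adj G z w ≡ true → LEdge a k l
      adj⇒LEdge pen hw e with p-neighbour e
      ... | refl with v-at hw
      ...   | refl = unpend
      adj⇒LEdge hz@(cyc _) pen e with p-neighbour (adj-swap _ _ e)
      ... | eq with v-at (subst (λ z → At z _) eq hz)
      ...   | refl = pend
      adj⇒LEdge (cyc {k} k≤) (cyc {l} l≤) e with walk-neighbour inj back k≤ (c∈ l , e)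
      ... | j , j≤ , q , h with inj (s≤s j≤) (s≤s l≤) q
      ...   | refl = h

      LEdge⇒adj : ∀ {z w k l} → At z k → At w l → LEdge a k l → adj G z w ≡ true
      LEdge⇒adj hz hw (up {x} x<a) with at-functional hz (cyc (<⇒≤ x<a)) | at-functional hw (cyc x<a)
      ... | refl | refl = c-adj x
      LEdge⇒adj hz hw (down {x} x<a) with at-functional hz (cyc x<a) | at-functional hw (cyc (<⇒≤ x<a))
      ... | refl | refl = adj-swap _ _ (c-adj x)
      LEdge⇒adj hz hw wrap with at-functional hz (cyc ≤-refl) | at-functional hw (cyc z≤n)
      ... | refl | refl = adj-swap _ _ (proj₂ (last-prev inj back))
      LEdge⇒adj hz hw unwrap with at-functional hz (cyc z≤n) | at-functional hw (cyc ≤-refl)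
      ... | refl | refl = proj₂ (last-prev inj back)
      LEdge⇒adj hz hw pend with at-functional hz (cyc z≤n) | at-functional hw pen
      ... | refl | refl = subst (λ z → adj G z p ≡ true) (sym c0) (adj-swap _ _ pv)
      LEdge⇒adj hz hw unpend with at-functional hz pen | at-functional hw (cyc z≤n)
      ... | refl | refl = subst (λ z → adj G p z ≡ true) (sym c0) pv

      place : ∀ k → k < 2 + a → ∃ λ z → At z k
      place k k< with m≤n⇒m<n∨m≡n (≤-pred k<)
      ... | inj₁ k<1+a = c k , cyc (≤-pred k<1+a)
      ... | inj₂ refl  = p , pen

      to from : Fin (2 + a) → Fin (2 + a)
      to z   = fromℕ< (proj₁ (proj₂ (at z)))
      from i = proj₁ (place (toℕ i) (toℕ<n i))

      at-to : ∀ z → At z (toℕ (to z))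
      at-to z = subst (At z) (sym (toℕ-fromℕ< (proj₁ (proj₂ (at z))))) (proj₂ (proj₂ (at z)))

      at-from : ∀ i → At (from i) (toℕ i)
      at-from i = proj₂ (place (toℕ i) (toℕ<n i))

      iso : adj G ≅ LAdj (2 + a)
      iso = mk↔ₛ′ to from
              (λ i → toℕ-injective (at-injective (at-to (from i)) (at-from i) refl))
              (λ z → at-functional (at-from (to z)) (at-to z))
          , λ i j → trans (bool-ext (λ e → LEdge⇒ladj (adj⇒LEdge (at-to i) (at-to j) e))
                                    (λ h → LEdge⇒adj (at-to i) (at-to j) (ladj⇒LEdge h)))
                          (sym (LAdj-ladj a (to i) (to j)))

    cycle-iso : adj G ≅ LAdj (2 + a)
    cycle-iso with closed-walk
    ... | t , inj , back with t≡a inj back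
    ...   | refl = iso inj back

-- Numerical comparison

triangle-+ : ∀ m k → triangle (m + k) ≡ triangle m + (triangle k + m * k)
triangle-+ zero    k = sym (+-identityʳ (triangle k))
triangle-+ (suc m) k = trans (cong (suc (m + k) +_) (triangle-+ m k))
  (solve 4 (λ m k s t → con 1 :+ (m :+ k) :+ (s :+ (t :+ m :* k)) := con 1 :+ m :+ s :+ (t :+ (k :+ m :* k))) refl
    m k (triangle m) (triangle k))
  where open +-*-Solver

F-of-L : ℕ → ℕ
F-of-L a = suc (triangle a + (2 * (2 + a) + 2 * triangle a))

bound : ℕ → ℕ → ℕ → ℕ
bound e a r = (suc e + triangle a) * suc (triangle r) + (triangle a + r)

bound-mono : ∀ {e e′} a r → e ≤ e′ → bound e a r ≤ bound e′ a r
bound-mono a r h = +-monoˡ-≤ (triangle a + r) (*-monoˡ-≤ (suc (triangle r)) (+-monoˡ-≤ (triangle a) (s≤s h)))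

-- With `a + 1` edges both sides would agree. One more edge enters with the factor `1 + T(1) = 2`,
-- so the excess is exactly 2.
bound-extra-edge : ∀ a → F-of-L a < bound (2 + a) a 1
bound-extra-edge a = subst (F-of-L a <_)
  (solve 2 (λ a t → con 1 :+ (t :+ (con 2 :* (con 2 :+ a) :+ con 2 :* t)) :+ con 2
     := (con 3 :+ a :+ t) :* con 2 :+ (t :+ con 1)) refl a (triangle a))
  (m<m+n (F-of-L a) (s≤s z≤n))
  where open +-*-Solver

-- The sizes `suc a` of A and `2 + y` of R avoid subtraction. After expanding the triangular number
-- of the sum, the difference is a polynomial in `a`, `y` and their triangular numbers with no
-- negative coefficient and constant term 1.
bound-large-rest : ∀ a y → F-of-L (suc a + suc y) < bound (suc (suc a)) (suc a) (2 + y)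
bound-large-rest a y = subst₂ _<_ (sym lhs)
  (solve 4 (λ a y t u →
     con 1 :+ (s a y t u :+ (con 2 :* (con 2 :+ (con 1 :+ a :+ (con 1 :+ y))) :+ con 2 :* s a y t u))
       :+ (con 1 :+ (a :+ t :+ u :* a :+ (con 1 :+ a :+ t) :* u :+ t :+ t :* y :+ (con 1 :+ a :+ t) :* y))
     := (con 3 :+ a :+ (con 1 :+ a :+ t)) :* (con 1 :+ (con 2 :+ y :+ (con 1 :+ y :+ u))) :+ (con 1 :+ a :+ t :+ (con 2 :+ y)))
     refl a y (triangle a) (triangle y))
  (m<m+n _ (s≤s z≤n))
  where
  open +-*-Solver
  s : ∀ {n} → Polynomial n → Polynomial n → Polynomial n → Polynomial n → Polynomial n
  s a y t u = (con 1 :+ a :+ t) :+ ((con 1 :+ y :+ u) :+ (con 1 :+ a) :* (con 1 :+ y))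
  S : ℕ
  S = triangle (suc a) + (triangle (suc y) + suc a * suc y)
  lhs : F-of-L (suc a + suc y) ≡ suc (S + (2 * (2 + (suc a + suc y)) + 2 * S))
  lhs = cong (λ k → suc (k + (2 * (2 + (suc a + suc y)) + 2 * k))) (triangle-+ (suc a) (suc y))

-- From the hypotheses on cut vertices, cycles and minimality to the isomorphism

module _ {n : ℕ} (G : Graph n) where

  -- `IsCutVertex` is a negation, so its failure gives a doubly negated statement; decidable
  -- reachability removes the negations.
  unique-cut : CountIs (IsCutVertex G) 1 → ∃ λ v → IsCutVertex G v ×
               (∀ x → x ≢ v → ∀ u w → u ≢ x → w ≢ x → Reach (DeleteAdj G x) u w)
  unique-cut (v ∷ [] , _ , cut ∷ [] , only , _) = v , cut , λ x x≢v →
    decidable-stable (all? λ u → all? λ w → ¬? (u ≟ x) →-dec (¬? (w ≟ x) →-dec reach? (DeleteAdj G x) u w))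
      (λ x-cut → x≢v (is-v (only x x-cut)))
    where
    is-v : ∀ {x} → x ∈ v ∷ [] → x ≡ v
    is-v (here p) = p
  unique-cut ([] , _ , _ , _ , ())
  unique-cut (_ ∷ _ ∷ _ , _ , _ , _ , ())

  edge-off : Connected G → ¬ IsTree G → (v : Fin n) → ∃₂ λ x y → x ≢ v × y ≢ v × adj G x y ≡ true
  edge-off conn ¬tree v = decidable-stable
    (any? λ x → any? λ y → ¬? (x ≟ v) ×-dec ¬? (y ≟ v) ×-dec (adj G x y Bool.≟ true))
    (λ none → ¬tree (conn , λ cycle → none (find cycle)))
    where
    find : HasCycle G → ∃₂ λ x y → x ≢ v × y ≢ v × adj G x y ≡ true
    find (m , f , inj , along , closing) with f zero ≟ v | f (suc zero) ≟ v
    -- At most one of the first two cycle vertices is `v`. The edge is the first one of the cycle,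
    -- the second if `v` comes first, and the closing one if `v` comes second.
    ... | no p | no q = _ , _ , p , q , along zero
    ... | yes p | _ = _ , _ , (λ e → Fin.0≢1+n (inj (trans p (sym e)))) , (λ e → Fin.0≢1+n (inj (trans p (sym e)))) , along (suc zero)
    ... | no p | yes q = _ , _ , (λ e → last≢1 (inj (trans e (sym q)))) , p , closing
      where
      last≢1 : ∀ {k} → fromℕ (suc (suc k)) ≢ suc zero
      last≢1 ()

theorem4p7 : ∀ (n : ℕ) → 4 ≤ n → (G₀ : Graph n) → InC' 1 G₀ →
    (∀ (G : Graph n) → InC' 1 G → ∀ k₀ k → F G₀ k₀ → F G k → k₀ ≤ k) →
    adj G₀ ≅ LAdj n
theorem4p7 (suc (suc (suc (suc q)))) (s≤s (s≤s (s≤s (s≤s z≤n)))) G₀ ((conn , cuts) , ¬tree) minimal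
  with unique-cut G₀ cuts
... | v , v-cut , noncut with edge-off G₀ conn ¬tree v
...   | x₀ , y₀ , x₀≢v , y₀≢v , x₀y₀ = by-rest lR refl
  where
  open LowerBound G₀ conn v noncut x₀ y₀ x₀≢v y₀≢v x₀y₀

  upper : bound (length edges) (length lA) (length lR) ≤ F-of-L (2 + q)
  upper =
    let k₀ , c₀ = F-exists G₀
        k , c , k≤ = UpperBound.F-L q
    in ≤-trans (F-≥ c₀) (≤-trans (minimal (LGraph.L q) (LGraph.L∈C′ q) k₀ k c₀ c) k≤)

  by-rest : ∀ l → l ≡ lR → adj G₀ ≅ LAdj (4 + q)
  -- With R empty, A is all of `G₀` minus `v`, so `v` would not be a cut vertex.
  by-rest [] eq = ⊥-elim (v-cut λ u w u≢v w≢v → A-reach (∈A u≢v) (∈A w≢v))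
    where
    ∈A : ∀ {z} → z ≢ v → z ∈ lA
    ∈A {z} z≢v with cases z
    ... | inj₁ z≡v = ⊥-elim (z≢v z≡v)
    ... | inj₂ (inj₁ z∈) = z∈
    ... | inj₂ (inj₂ z∈) with subst (z ∈_) (sym eq) z∈
    ...   | ()
  by-rest (p ∷ []) eq = CycleIso.cycle-iso G₀ conn v noncut x₀ y₀ x₀≢v y₀≢v x₀y₀
    -- A block vertex of degree 3 would bring an extra edge and push the lower bound above the value
    -- for L.
    (λ u∈ → ≮⇒≥ λ 3≤ → <⇒≱ (bound-extra-edge (2 + q))
      (≤-trans (bound-mono (2 + q) 1 (subst (λ k → 2 + k ≤ length edges) |A| (edges-> u∈ 3≤)))
        (subst₂ (λ k r → bound (length edges) k r ≤ F-of-L (2 + q)) |A| (sym (cong length eq)) upper)))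
    p (subst (p ∈_) eq (here refl)) (λ {z} z∈ → is-p (subst (z ∈_) (sym eq) z∈)) |A|
    where
    is-p : ∀ {z} → z ∈ p ∷ [] → z ≡ p
    is-p (here h) = h
    |A| : length lA ≡ 2 + q
    |A| = +-cancelʳ-≡ 2 (length lA) (2 + q) (trans (trans (sym (+-assoc (length lA) 1 1))
      (trans (cong (λ r → length lA + r + 1) (cong length eq)) vertices)) (+-comm 2 (2 + q)))
  by-rest (p ∷ p′ ∷ rest) eq = ⊥-elim (too-many (length lA) refl)
    where
    too-many : ∀ k → k ≡ length lA → ⊥
    too-many zero h = <⇒≱ (s≤s z≤n) (subst (2 ≤_) (sym h) 2≤a)
    too-many (suc k) h = <⇒≱ (bound-large-rest k (length rest)) (subst (bound (suc (suc k)) (suc k) (2 + length rest) ≤_)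
      (cong F-of-L (sym size))
      (≤-trans (bound-mono (suc k) (2 + length rest) (subst (λ j → suc j ≤ length edges) (sym h) edges-≥))
        (subst₂ (λ j r → bound (length edges) j r ≤ F-of-L (2 + q)) (sym h) (sym (cong length eq)) upper)))
      where
      size : suc k + suc (length rest) ≡ 2 + q
      size = +-cancelʳ-≡ 2 (suc k + suc (length rest)) (2 + q) (trans
        (trans (solve 2 (λ k r → con 1 :+ k :+ (con 1 :+ r) :+ con 2 := con 1 :+ k :+ (con 2 :+ r) :+ con 1) refl k (length rest))
          (trans (cong₂ (λ j r → j + r + 1) h (cong length eq)) vertices)) (+-comm 2 (2 + q)))
        where open +-*-Solver
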